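{- With $\tilde h_n(q)=q^{n(n-1)/2}h_n(q^{ -1})$, one has, as formal power series in $s$, $$\sum_{n\ge0}\tilde h_n(q)s^n=\cfrac{1}{1-\cfrac{c_1 s}{1-\cfrac{c_2 s}{1-\cfrac{c_3 s}{1-\cdots}}}},$$ where $c_{2m-1}=\binom{m+1}{2}_q$ and $c_{2m}=q\binom{m+1}{2}_q$ for $m\ge1$; explicitly $$\sum_{n\ge 0}\tilde h_n(q)s^n=\cfrac{1}{1-\cfrac{s}{1-\cfrac{qs}{1-\cfrac{\binom{3}{2}_q s}{1-\cfrac{q\binom{3}{2}_q s}{1-\cfrac{\binom{4}{2}_q s}{1-\cfrac{q\binom{4}{2}_q s}{1-\cdots}}}}}}}.$$
   Context: Gaussian binomial coefficients: for $m\ge k\ge 0$, $\binom{m}{k}_q=\frac{[m]_q!}{[k]_q!\,[m-k]_q!}$ with $[m]_q!=\prod_{i=1}^m\frac{1-q^i}{1-q}$; set $\binom{m}{k}_q=0$ if $k>m$ or $k<0$. Let $W$ be an $n$-dimensional complex vector space with basis $w_1,\dots,w_n$, and $pr_k:W\to W$ the projection with $pr_k(\sum_i c_iw_i)=\sum_{i\ne k}c_iw_i$. The degenerate flag variety $\mathrm{Fl}^a_n$ is the variety of tuples $(V_1,\dots,V_{n-1})$ of subspaces of $W$ with $\dim V_k=k$ and $pr_{k+1}V_k\subset V_{k+1}$ for $k=1,\dots,n-2$. It admits a cellular decomposition into complex affine cells, so its Poincaré polynomial $P(t)$ involves only even powers of $t$; define $h_n(q)=P(q^{1/2})$, a polynomial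 of degree $n(n-1)/2$ with $h_0(q)=h_1(q)=1$. It is known (Cerulli Irelli–Feigin–Reineke) that $$h_n(q)=\sum_{f_1,\dots,f_{n-1}\ge 0} q^{\sum_{k=1}^{n-1}(k-f_k)(1-f_k+f_{k+1})}\prod_{k=1}^{n-1}\binom{1+f_{k-1}}{f_k}_{\!q}\prod_{k=1}^{n-1}\binom{1+f_{k+1}}{f_k}_{\!q},$$ with the convention $f_0=f_n=0$. -}

module Defs where

open import Data.Bool.Base using (if_then_else_)
open import Data.Integer.Base as ℤ using (ℤ; 0ℤ; 1ℤ; +_)
import Data.Integer.Properties as ℤ
open import Data.List.Base
  using (List; []; _∷_; _++_; map; foldr; upTo; cartesianProductWith)
open import Data.List.Membership.Propositional using (_∈_)
open import Data.List.Membership.Propositional.Properties using (∈-map⁺; ∈-upTo⁺)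
open import Data.List.Properties using (cartesianProductWith-zeroʳ)
open import Data.List.Relation.Unary.Any using (here; there)
open import Data.Nat.Base as ℕ using (ℕ; zero; suc; _≤_; _<_; z≤n; s≤s; ⌈_/2⌉)
open import Data.Nat.DivMod using (_/_; _%_)
import Data.Nat.Properties as ℕ
open import Data.Product.Base using (_×_; _,_; ∃-syntax)
open import Data.Vec.Base using (Vec; []; _∷_)
open import Relation.Binary.PropositionalEquality using (_≡_; refl; cong; trans)
open import Relation.Nullary using (does; yes; no)
open import Relation.Nullary.Decidable using (dec-false)

infix  4 _≈_ _⟶_
infixl 6 _⊕_ _⊖_
infixl 7 _⊗_ _÷_ _⊛_
infixr 8 q^_
infix  9 _at_ _[q⁻¹]

-- An element of ℤ[q , q⁻¹], as a formal sum of terms (c , e), each standing for c·qᵉ.  Exponents may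
-- repeat and coefficients may vanish, so equality is _≈_ and not _≡_.
Laurent : Set
Laurent = List (ℤ × ℤ)

coeff : Laurent → ℤ → ℤ
coeff []            z = 0ℤ
coeff ((c , e) ∷ p) z = (if does (e ℤ.≟ z) then c else 0ℤ) ℤ.+ coeff p z

_≈_ : Laurent → Laurent → Set
p ≈ r = ∀ z → coeff p z ≡ coeff r z

monomial : ℤ → ℤ → Laurent
monomial c e = (c , e) ∷ []

q^_ : ℤ → Laurent
q^ e = monomial 1ℤ e

0L 1L q : Laurent
0L = []
1L = q^ 0ℤ
q  = q^ 1ℤ

_⊕_ _⊗_ _⊖_ : Laurent → Laurent → Laurent
p ⊕ r = p ++ r
p ⊗ r = cartesianProductWith (λ (c , i) (d , j) → c ℤ.* d , i ℤ.+ j) p r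
p ⊖ r = p ⊕ map (λ (c , e) → ℤ.- c , e) r

-- p(q) ↦ p(q⁻¹)
_[q⁻¹] : Laurent → Laurent
p [q⁻¹] = map (λ (c , e) → c , ℤ.- e) p

degreeBound : Laurent → ℕ
degreeBound = foldr (λ (c , e) d → ℤ.∣ e ∣ ℕ.⊔ d) 0

-- The terms of degree i, …, i + n - 1 of the quotient a / b, found by
-- division in ascending powers of q; b is to have constant term 1 and no
-- negative powers.
divide : (n i : ℕ) (a b : Laurent) → Laurent
divide zero    i a b = 0L
divide (suc n) i a b = t ⊕ divide n (suc i) (a ⊖ t ⊗ b) b
  where t = monomial (coeff a (+ i)) (+ i)

-- The exact quotient of polynomials, when b has constant term 1 and b ∣ a.
-- All divisors below (1 - q and products of q-factorials) are of this kind.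
_÷_ : Laurent → Laurent → Laurent
a ÷ b = divide (suc (degreeBound a)) 0 a b

[1⋯_] : ℕ → List ℕ
[1⋯ m ] = map suc (upTo m)

∑ : {A : Set} → List A → (A → Laurent) → Laurent
∑ xs t = foldr (λ x s → t x ⊕ s) 0L xs

∏ : {A : Set} → List A → (A → Laurent) → Laurent
∏ xs t = foldr (λ x s → t x ⊗ s) 1L xs

∑ℤ : {A : Set} → List A → (A → ℤ) → ℤ
∑ℤ xs t = foldr (λ x s → t x ℤ.+ s) 0ℤ xs

[_]! : ℕ → Laurent
[ m ]! = ∏ [1⋯ m ] λ i → (1L ⊖ q^ (+ i)) ÷ (1L ⊖ q)

binom : ℕ → ℕ → Laurent
binom m k = if does (k ℕ.≤? m) then [ m ]! ÷ ([ k ]! ⊗ [ m ℕ.∸ k ]!) else 0L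

-- f at k is f_k for f = (f₁ , … , f_m), and 0 for k = 0 and for k > m.
_at_ : ∀ {m} → Vec ℕ m → ℕ → ℕ
f       at zero          = 0
[]      at suc k         = 0
(x ∷ f) at suc zero      = x
(x ∷ f) at suc (suc k)   = f at suc k

-- All (f₁ , … , f_m) with 0 ≤ f_k ≤ b.
tuples : (b m : ℕ) → List (Vec ℕ m)
tuples b zero    = [] ∷ []
tuples b (suc m) = cartesianProductWith _∷_ (upTo (suc b)) (tuples b m)

exponent : ∀ n → Vec ℕ (n ℕ.∸ 1) → ℤ
exponent n f = ∑ℤ [1⋯ n ℕ.∸ 1 ] λ k →
  (+ k ℤ.- + (f at k)) ℤ.* (1ℤ ℤ.- + (f at k) ℤ.+ + (f at suc k))

summand : ∀ n → Vec ℕ (n ℕ.∸ 1) → Laurent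
summand n f =
    q^ (exponent n f)
  ⊗ (∏ [1⋯ n ℕ.∸ 1 ] λ k → binom (1 ℕ.+ f at (k ℕ.∸ 1)) (f at k))
  ⊗ (∏ [1⋯ n ℕ.∸ 1 ] λ k → binom (1 ℕ.+ f at suc k) (f at k))

-- The Poincaré polynomial of Flᵃₙ in the variable q = t², through the
-- Cerulli Irelli–Feigin–Reineke formula.  There the sum is over all
-- f₁, …, fₙ₋₁ ≥ 0; a summand with some f_k > k is zero (summand-vanishes),
-- so f_k ≤ n - 1 loses nothing.
h : ℕ → Laurent
h n = ∑ (tuples (n ℕ.∸ 1) (n ℕ.∸ 1)) (summand n)

h̃ : ℕ → Laurent
h̃ n = q^ (+ (n ℕ.* (n ℕ.∸ 1) / 2)) ⊗ (h n) [q⁻¹]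

-- F : Series is the formal power series ∑ₙ F n · sⁿ.
Series : Set
Series = ℕ → Laurent

1S : Series
1S zero    = 1L
1S (suc n) = 0L

_⊛_ : Series → Series → Series
(F ⊛ G) n = ∑ (upTo (suc n)) λ i → F i ⊗ G (n ℕ.∸ i)

_^S_ : Series → ℕ → Series
F ^S zero  = 1S
F ^S suc k = F ⊛ (F ^S k)

-- c · s · F
_·s·_ : Laurent → Series → Series
(c ·s· F) zero    = 0L
(c ·s· F) (suc n) = c ⊗ F n

-- 1 / (1 - F) = ∑ₖ Fᵏ for F with zero constant term, in which case Fᵏ has
-- no terms of degree n < k.
1/[1-_] : Series → Series
1/[1- F ] n = ∑ (upTo (suc n)) λ k → (F ^S k) n

-- The fraction 1/(1 - c_{i+1}s/(1 - c_{i+2}s/(⋯/(1 - c_{i+N}s)))).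
fraction : (ℕ → Laurent) → (i N : ℕ) → Series
fraction c i zero    = 1S
fraction c i (suc N) = 1/[1- c (suc i) ·s· fraction c (suc i) N ]

convergent : (ℕ → Laurent) → ℕ → Series
convergent c = fraction c 0

-- Convergence of formal power series: each coefficient is eventually
-- constant.  An infinite continued fraction is the limit of its convergents.
_⟶_ : (ℕ → Series) → Series → Set
F ⟶ G = ∀ n → ∃[ M ] ∀ N → M ≤ N → F N n ≈ G n

-- With m = ⌈ i /2⌉, odd i is 2m - 1 and even i is 2m.  The value at i = 0
-- is not used.
c : ℕ → Laurent
c i = if i % 2 ℕ.≡ᵇ 1 then binom (⌈ i /2⌉ ℕ.+ 1) 2
                      else q ⊗ binom (⌈ i /2⌉ ℕ.+ 1) 2

private

  ∏-zero : {A : Set} {x : A} (xs : List A) (t : A → Laurent) →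
           x ∈ xs → t x ≡ 0L → ∏ xs t ≡ 0L
  ∏-zero (x ∷ xs) t (here refl) eq = cong (_⊗ ∏ xs t) eq
  ∏-zero (x ∷ xs) t (there x∈)  eq =
    trans (cong (t x ⊗_) (∏-zero xs t x∈ eq)) (cartesianProductWith-zeroʳ _ (t x))

  at-support : ∀ {m} (f : Vec ℕ m) k → 0 < f at suc k → k < m
  at-support (x ∷ f) zero    _ = s≤s z≤n
  at-support (x ∷ f) (suc k) p = s≤s (at-support f k p)

  binom-zero : ∀ {m k} → m < k → binom m k ≡ 0L
  binom-zero {m} {k} m<k =
    cong (if_then [ m ]! ÷ ([ k ]! ⊗ [ m ℕ.∸ k ]!) else 0L)
         (dec-false (k ℕ.≤? m) (ℕ.<⇒≱ m<k))

  ⊗-zero-middle : ∀ p {r} s → r ≡ 0L → p ⊗ r ⊗ s ≡ 0L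
  ⊗-zero-middle p s refl = cong (_⊗ s) (cartesianProductWith-zeroʳ _ p)

summand-vanishes : ∀ n (f : Vec ℕ (n ℕ.∸ 1)) k → k < f at k → summand n f ≡ 0L
summand-vanishes n f (suc k) k<fk with k ℕ.<? f at k
... | yes p = summand-vanishes n f k p
... | no ¬p =
  ⊗-zero-middle (q^ exponent n f) _
    (∏-zero [1⋯ n ℕ.∸ 1 ] (λ j → binom (1 ℕ.+ f at (j ℕ.∸ 1)) (f at j))
      (∈-map⁺ suc (∈-upTo⁺ (at-support f k (ℕ.≤-<-trans z≤n k<fk))))
      (binom-zero (ℕ.≤-<-trans (s≤s (ℕ.≮⇒≥ ¬p)) k<fk)))

module Submission where

-- In a nonzero summand of h n consecutive entries of 0 , f₁ , … , fₙ₋₁ , 0 differ by at most 1, so h̃ n is a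
-- weighted count of Motzkin paths of length n.  The exponent of q, which involves the position k, splits into
-- position-independent step weights and a telescoping part.  With [a] the q-integers and T a the Gaussian
-- binomial coefficient of a + 2 over 2, a level step at height a has weight [a + 1]², and a pair of a rise and
-- a fall between a and a + 1 has weight q (T a)².  By the identity T (a + 1) + q T a = [a + 2]² these are the
-- weights c₂ₐ + c₂ₐ₊₁ and c₂ₐ₊₁ c₂ₐ₊₂ of pairs of steps of Dyck paths, whose generating function is the
-- continued fraction with coefficients c₁ , c₂ , …

open import Defs
open import Algebra.Bundles using (CommutativeRing; CommutativeSemiring)
import Algebra.Properties.Ring
import Algebra.Solver.Ring.NaturalCoefficients.Default
open import Data.Bool.Base using (true; false; if_then_else_)
open import Data.Integer.Base as ℤ using (ℤ; 0ℤ; 1ℤ; +_; +≤+; +<+)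
import Data.Integer.Properties as ℤ
open import Data.Integer.Solver using (module +-*-Solver)
open import Data.List.Base using (List; []; _∷_; _++_; map; foldr; applyUpTo; upTo; cartesianProductWith)
open import Data.List.Membership.Propositional using (_∈_)
import Data.List.Membership.Propositional.Properties as ∈
import Data.List.Properties as List
open import Data.List.Relation.Unary.All as All using (All; []; _∷_)
import Data.List.Relation.Unary.All.Properties as All
open import Data.List.Relation.Unary.Any using (here; there)
open import Data.Nat.Base as ℕ using (ℕ; zero; suc; _∸_; _≤_; _<_; z≤n; s≤s; ⌈_/2⌉)
open import Data.Nat.DivMod using (_/_; m*n/n≡m; m*n%n≡0; [m+kn]%n≡m%n)
import Data.Nat.Properties as ℕ
import Data.Nat.Solver
open import Data.Product using (_×_; _,_; proj₁; proj₂; ∃-syntax)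
open import Data.Vec.Base using (Vec; []; _∷_)
open import Function.Base using (_∘_; id)
open import Function.Bundles using (mk⇔)
open import Level using (0ℓ)
open import Relation.Binary.Definitions using (tri<; tri≈; tri>)
import Relation.Binary.PropositionalEquality as ≡
import Relation.Binary.Reasoning.Setoid
open import Relation.Nullary using (does; yes; no; ¬_; contradiction)
open import Relation.Nullary.Decidable using (dec-true; dec-false; does-⇔)

-- Sums, paths and q-integers in a commutative semiring

-- The weight of a closed path depends on its rises and falls only through products of matching
-- pairs. This is why the exponent of a step may be changed by a telescoping term, and why a single
-- fall may carry a negative power of `q`. The terms k left over after telescoping add up to n(n -
-- 1)/2, the power of `q` in `h̃`. Inverting `q` in a Gaussian binomial costs a further power, by
-- palindromicity, and this is absorbed into the step exponent.
--
-- No series is ever divided. The coefficients `D` of products of consecutive tails of the fraction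
-- obey a recursion free of subtraction, so the combinatorial half works over any commutative
-- semiring. Subtraction and division of polynomials serve only to identify `binom` with `[_]` and
-- `T`. The obstacle there is that `÷` runs for a number of steps read off the list of terms of the
-- dividend, so it must be excluded that the quotient is cut short.

module Sums (R : CommutativeSemiring 0ℓ 0ℓ) where
  open CommutativeSemiring R hiding (zero) renaming (_≈_ to _≃_)
  open Algebra.Solver.Ring.NaturalCoefficients.Default R
  open Relation.Binary.Reasoning.Setoid setoid

  ∑< : ℕ → (ℕ → Carrier) → Carrier
  ∑< zero    f = 0#
  ∑< (suc n) f = f 0 + ∑< n (f ∘ suc)

  ∑<-cong : ∀ n {f g} → (∀ {i} → i < n → f i ≃ g i) → ∑< n f ≃ ∑< n g
  ∑<-cong zero    eq = refl
  ∑<-cong (suc n) eq = +-cong (eq (s≤s z≤n)) (∑<-cong n λ i<n → eq (s≤s i<n))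

  ∑<-zero : ∀ n {f} → (∀ {i} → i < n → f i ≃ 0#) → ∑< n f ≃ 0#
  ∑<-zero zero    eq = refl
  ∑<-zero (suc n) eq =
    trans (+-cong (eq (s≤s z≤n)) (∑<-zero n λ i<n → eq (s≤s i<n))) (+-identityˡ 0#)

  ∑<-+ : ∀ n f g → ∑< n (λ i → f i + g i) ≃ ∑< n f + ∑< n g
  ∑<-+ zero    f g = sym (+-identityˡ 0#)
  ∑<-+ (suc n) f g = trans (+-congˡ (∑<-+ n (f ∘ suc) (g ∘ suc)))
    (solve 4 (λ a b x y → (a :+ b) :+ (x :+ y) := (a :+ x) :+ (b :+ y)) refl
      (f 0) (g 0) (∑< n (f ∘ suc)) (∑< n (g ∘ suc)))

  ∑<-*ˡ : ∀ n a f → ∑< n (λ i → a * f i) ≃ a * ∑< n f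
  ∑<-*ˡ zero    a f = sym (zeroʳ a)
  ∑<-*ˡ (suc n) a f = trans (+-congˡ (∑<-*ˡ n a (f ∘ suc))) (sym (distribˡ a _ _))

  ∑<-last : ∀ n f → ∑< (suc n) f ≃ ∑< n f + f n
  ∑<-last zero    f = +-comm (f 0) 0#
  ∑<-last (suc n) f = trans (+-congˡ (∑<-last n (f ∘ suc))) (sym (+-assoc _ _ _))

  ∑<-swap : ∀ m n (f : ℕ → ℕ → Carrier) → ∑< m (λ i → ∑< n (f i)) ≃ ∑< n (λ j → ∑< m (λ i → f i j))
  ∑<-swap zero    n f = sym (∑<-zero n λ _ → refl)
  ∑<-swap (suc m) n f = trans (+-congˡ (∑<-swap m n (f ∘ suc))) (sym (∑<-+ n (f 0) _))

  ∑<-truncate : ∀ {m n} f → m ≤ n → (∀ {i} → m ≤ i → f i ≃ 0#) → ∑< n f ≃ ∑< m f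
  ∑<-truncate {n = n} f z≤n       f≃0 = ∑<-zero n λ _ → f≃0 z≤n
  ∑<-truncate         f (s≤s m≤n) f≃0 = +-congˡ (∑<-truncate (f ∘ suc) m≤n λ m≤i → f≃0 (s≤s m≤i))

module Paths (R : CommutativeSemiring 0ℓ 0ℓ) (γ : ℕ → CommutativeSemiring.Carrier R) where
  open CommutativeSemiring R hiding (zero) renaming (_≈_ to _≃_)
  open Algebra.Solver.Ring.NaturalCoefficients.Default R
  open Relation.Binary.Reasoning.Setoid setoid
  open Sums R

  -- If Fᵢ = 1/(1 - γᵢ₊₁s/(1 - γᵢ₊₂s/⋯)), then D i n j is the coefficient of sⁿ in Fᵢ Fᵢ₊₁ ⋯ Fᵢ₊ⱼ₋₁,
  -- computed from Fₖ = 1 + γₖ₊₁ s Fₖ Fₖ₊₁ for the last factor.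
  D : ℕ → ℕ → ℕ → Carrier
  D i zero    j       = 1#
  D i (suc n) zero    = 0#
  D i (suc n) (suc j) = D i (suc n) j + γ (suc (i ℕ.+ j)) * D i n (suc (suc j))

  -- The recursion of `D` unfolds the last factor of the product, the continued fraction the first.
  -- Splitting off the first factor is compatible with unfolding the last, since both sides then
  -- obey the same recursion.
  D-convolution : ∀ i n j → D i n (suc j) ≃ ∑< (suc n) λ k → D (suc i) k j * D i (n ∸ k) 1
  D-convolution i zero    j    = sym (trans (+-identityʳ _) (*-identityˡ 1#))
  D-convolution i (suc n) zero = sym (begin
    1# * D i (suc n) 1 + ∑< (suc n) (λ k → 0# * D i (n ∸ k) 1)
      ≈⟨ +-cong (*-identityˡ _) (∑<-zero (suc n) λ {k} _ → zeroˡ (D i (n ∸ k) 1)) ⟩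
    D i (suc n) 1 + 0#
      ≈⟨ +-identityʳ _ ⟩
    D i (suc n) 1 ∎)
  D-convolution i (suc n) (suc j) = begin
    D i (suc n) (suc j) + γ (suc (i ℕ.+ suc j)) * D i n (suc (suc (suc j)))
      ≈⟨ +-cong (D-convolution i (suc n) j)
           (*-cong (reflexive (≡.cong (γ ∘ suc) (ℕ.+-suc i j))) (D-convolution i n (suc (suc j)))) ⟩
    (1# * F (suc n) + ∑< (suc n) (λ k → A k * F (n ∸ k))) + g * ∑< (suc n) (λ k → B k * F (n ∸ k))
      ≈⟨ +-assoc _ _ _ ⟩
    1# * F (suc n) + (∑< (suc n) (λ k → A k * F (n ∸ k)) + g * ∑< (suc n) (λ k → B k * F (n ∸ k)))
      ≈⟨ +-congˡ (+-congˡ (∑<-*ˡ (suc n) g λ k → B k * F (n ∸ k))) ⟨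
    1# * F (suc n) + (∑< (suc n) (λ k → A k * F (n ∸ k)) + ∑< (suc n) (λ k → g * (B k * F (n ∸ k))))
      ≈⟨ +-congˡ (∑<-+ (suc n) (λ k → A k * F (n ∸ k)) (λ k → g * (B k * F (n ∸ k)))) ⟨
    1# * F (suc n) + ∑< (suc n) (λ k → A k * F (n ∸ k) + g * (B k * F (n ∸ k)))
      ≈⟨ +-congˡ (∑<-cong (suc n) λ {k} _ →
           solve 4 (λ a g b f → a :* f :+ g :* (b :* f) := (a :+ g :* b) :* f) refl
             (A k) g (B k) (F (n ∸ k))) ⟩
    1# * F (suc n) + ∑< (suc n) (λ k → (A k + g * B k) * F (n ∸ k)) ∎
    where
    F A B : ℕ → Carrier
    F m = D i m 1
    A k = D (suc i) (suc k) j
    B k = D (suc i) k (suc (suc j))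
    g = γ (suc (suc i ℕ.+ j))

  -- Dyck paths of t steps from height j down to 0; the step from k to k + 1 has weight γₖ₊₁.
  X : ℕ → ℕ → Carrier
  X zero    zero    = 1#
  X zero    (suc j) = 0#
  X (suc t) zero    = γ 1 * X t 1
  X (suc t) (suc j) = X t j + γ (suc (suc j)) * X t (suc (suc j))

  X-vanishes : ∀ {t j} → t < j → X t j ≃ 0#
  X-vanishes {zero}  {suc j} _         = refl
  X-vanishes {suc t} {suc j} (s≤s t<j) = begin
    X t j + γ (suc (suc j)) * X t (suc (suc j))
      ≈⟨ +-cong (X-vanishes t<j) (*-congˡ (X-vanishes (ℕ.m<n⇒m<1+n (ℕ.m<n⇒m<1+n t<j)))) ⟩
    0# + γ (suc (suc j)) * 0#
      ≈⟨ trans (+-identityˡ _) (zeroʳ _) ⟩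
    0# ∎

  -- A path of j + 2n steps from height j to 0 has n rises. Cutting it at its first visits to j - 1,
  -- ..., 0 gives one factor for each of the tails from j down to 0, hence j + 1 factors. In the
  -- recursions the first step decides: a fall drops the last factor, a rise adds one and uses up
  -- one power of s.
  X≈D : ∀ n j → X (j ℕ.+ n ℕ.* 2) j ≃ D 0 n (suc j)
  X≈D zero    zero    = refl
  X≈D zero    (suc j) = begin
    X (j ℕ.+ 0) j + γ (suc (suc j)) * X (j ℕ.+ 0) (suc (suc j))
      ≈⟨ +-cong (X≈D zero j) (*-congˡ (X-vanishes (≡.subst (_< suc (suc j)) (≡.sym (ℕ.+-identityʳ j))
           (ℕ.m<n⇒m<1+n (ℕ.n<1+n j))))) ⟩
    1# + γ (suc (suc j)) * 0#
      ≈⟨ trans (+-congˡ (zeroʳ _)) (+-identityʳ 1#) ⟩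
    1# ∎
  X≈D (suc n) zero    = trans (*-congˡ (X≈D n 1)) (sym (+-identityˡ _))
  X≈D (suc n) (suc j) = +-cong (X≈D (suc n) j) (*-congˡ (trans
    (reflexive (≡.cong (λ t → X t (suc (suc j)))
      (≡.trans (ℕ.+-suc j (suc (n ℕ.* 2))) (≡.cong suc (ℕ.+-suc j (n ℕ.* 2))))))
    (X≈D n (suc (suc j)))))

  module Motzkin
    (w : ℕ → ℕ → Carrier)
    (w-fall : ∀ {a x} → suc x < a → w a x ≃ 0#)
    (w-flat₀ : w 0 0 ≃ γ 1)
    (w-flat : ∀ a → w (suc a) (suc a) ≃ γ (suc a ℕ.* 2) + γ (suc (suc a ℕ.* 2)))
    (w-peak : ∀ a → w a (suc a) * w (suc a) a ≃ γ (suc (a ℕ.* 2)) * γ (suc a ℕ.* 2))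
    where

    M : ℕ → ℕ → Carrier
    M zero    zero    = 1#
    M zero    (suc a) = 0#
    M (suc n) a       = ∑< (suc (suc a)) λ x → w a x * M n x

    -- Falls have weight 1 in `X`, while a Motzkin path from height a pays for its falls to 0.
    -- Moving the weight of every fall to the matching rise leaves this product over the a unmatched
    -- falls.
    K : ℕ → Carrier
    K zero    = 1#
    K (suc a) = w (suc a) a * K a

    -- Two steps of a Dyck path at even height make one step of a Motzkin path.
    M≈X : ∀ n a → M n a ≃ K a * X (n ℕ.* 2) (a ℕ.* 2)
    M≈X zero zero    = sym (*-identityˡ 1#)
    M≈X zero (suc a) = sym (zeroʳ _)
    M≈X (suc n) zero = begin
      w 0 0 * M n 0 + (w 0 1 * M n 1 + 0#)
        ≈⟨ +-cong (*-congˡ (M≈X n 0)) (+-congʳ (*-congˡ (M≈X n 1))) ⟩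
      w 0 0 * (1# * x₀) + (w 0 1 * (w 1 0 * 1# * x₂) + 0#)
        ≈⟨ solve 5 (λ f u d x₀ x₂ → f :* (con 1 :* x₀) :+ (u :* (d :* con 1 :* x₂) :+ con 0)
                                    := f :* x₀ :+ u :* d :* x₂) refl (w 0 0) (w 0 1) (w 1 0) x₀ x₂ ⟩
      w 0 0 * x₀ + w 0 1 * w 1 0 * x₂
        ≈⟨ +-cong (*-congʳ w-flat₀) (*-congʳ (w-peak 0)) ⟩
      γ 1 * x₀ + γ 1 * γ 2 * x₂
        ≈⟨ solve 4 (λ g₁ g₂ x₀ x₂ → g₁ :* x₀ :+ g₁ :* g₂ :* x₂ := con 1 :* (g₁ :* (x₀ :+ g₂ :* x₂)))
             refl (γ 1) (γ 2) x₀ x₂ ⟩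
      1# * (γ 1 * (x₀ + γ 2 * x₂)) ∎
      where
      x₀ = X (n ℕ.* 2) 0
      x₂ = X (n ℕ.* 2) 2
    M≈X (suc n) (suc a) = begin
      ∑< (3 ℕ.+ a) f
        ≈⟨ trans (∑<-last (2 ℕ.+ a) f) (+-congʳ (trans (∑<-last (suc a) f) (+-congʳ (∑<-last a f)))) ⟩
      ∑< a f + f a + f (suc a) + f (suc (suc a))
        ≈⟨ +-cong (+-cong (+-cong (∑<-zero a λ {x} x<a → trans (*-congʳ (w-fall (s≤s x<a))) (zeroˡ (M n x)))
             (*-congˡ (M≈X n a))) (*-congˡ (M≈X n (suc a)))) (*-congˡ (M≈X n (suc (suc a)))) ⟩
      0# + d * (K a * x₀) + w₁ * (d * K a * x₂) + u * (d′ * (d * K a) * x₄)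
        ≈⟨ solve 8 (λ d k w₁ u d′ x₀ x₂ x₄ →
             con 0 :+ d :* (k :* x₀) :+ w₁ :* (d :* k :* x₂) :+ u :* (d′ :* (d :* k) :* x₄)
             := d :* k :* (x₀ :+ w₁ :* x₂ :+ u :* d′ :* x₄)) refl d (K a) w₁ u d′ x₀ x₂ x₄ ⟩
      d * K a * (x₀ + w₁ * x₂ + u * d′ * x₄)
        ≈⟨ *-congˡ (+-cong (+-congˡ (*-congʳ (w-flat a))) (*-congʳ (w-peak (suc a)))) ⟩
      d * K a * (x₀ + (g₂ + g₃) * x₂ + g₃ * g₄ * x₄)
        ≈⟨ *-congˡ (solve 6 (λ g₂ g₃ g₄ x₀ x₂ x₄ →
             x₀ :+ (g₂ :+ g₃) :* x₂ :+ g₃ :* g₄ :* x₄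
             := x₀ :+ g₂ :* x₂ :+ g₃ :* (x₂ :+ g₄ :* x₄)) refl g₂ g₃ g₄ x₀ x₂ x₄) ⟩
      d * K a * (x₀ + g₂ * x₂ + g₃ * (x₂ + g₄ * x₄)) ∎
      where
      f : ℕ → Carrier
      f x = w (suc a) x * M n x
      d = w (suc a) a
      d′ = w (suc (suc a)) (suc a)
      u = w (suc a) (suc (suc a))
      w₁ = w (suc a) (suc a)
      g₂ = γ (suc a ℕ.* 2)
      g₃ = γ (suc (suc a ℕ.* 2))
      g₄ = γ (suc (suc a) ℕ.* 2)
      x₀ = X (n ℕ.* 2) (a ℕ.* 2)
      x₂ = X (n ℕ.* 2) (suc a ℕ.* 2)
      x₄ = X (n ℕ.* 2) (suc (suc a) ℕ.* 2)

    M≈D : ∀ n → M n 0 ≃ D 0 n 1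
    M≈D n = trans (M≈X n 0) (trans (*-identityˡ _) (X≈D n 0))

-- The powers of `q` are a parameter so that the monomials `q^ (+ n)` can be used as they are; both
-- laws then hold by computation.
module QIntegers (R : CommutativeSemiring 0ℓ 0ℓ)
  (q : CommutativeSemiring.Carrier R) (qⁿ : ℕ → CommutativeSemiring.Carrier R)
  (q⁰ : CommutativeSemiring._≈_ R (qⁿ 0) (CommutativeSemiring.1# R))
  (q¹⁺ⁿ : ∀ n → CommutativeSemiring._≈_ R (qⁿ (suc n)) (CommutativeSemiring._*_ R q (qⁿ n))) where
  open CommutativeSemiring R hiding (zero) renaming (_≈_ to _≃_)
  open Algebra.Solver.Ring.NaturalCoefficients.Default R
  open Relation.Binary.Reasoning.Setoid setoid

  [_] : ℕ → Carrier
  [ zero ]  = 0#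
  [ suc n ] = 1# + q * [ n ]

  -- The Gaussian binomial coefficient of a + 2 over 2.
  T : ℕ → Carrier
  T zero    = 1#
  T (suc a) = q * q * T a + [ suc (suc a) ]

  -- The definition adds the constant term, this form the top term. Inversion of `q` exchanges the
  -- two.
  [1+n] : ∀ n → [ suc n ] ≃ [ n ] + qⁿ n
  [1+n] zero    = trans (solve 1 (λ q → con 1 :+ q :* con 0 := con 0 :+ con 1) refl q) (+-congˡ (sym q⁰))
  [1+n] (suc n) = begin
    1# + q * [ suc n ]
      ≈⟨ +-congˡ (*-congˡ ([1+n] n)) ⟩
    1# + q * ([ n ] + qⁿ n)
      ≈⟨ solve 3 (λ q x y → con 1 :+ q :* (x :+ y) := con 1 :+ q :* x :+ q :* y) refl q [ n ] (qⁿ n) ⟩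
    1# + q * [ n ] + q * qⁿ n
      ≈⟨ +-congˡ (q¹⁺ⁿ n) ⟨
    1# + q * [ n ] + qⁿ (suc n) ∎

  -- The quotient formula [a + 2][a + 1] / [2] for the Gaussian binomial, cleared of its
  -- denominator.
  T-product : ∀ a → (1# + q) * T a ≃ [ 2 ℕ.+ a ] * [ 1 ℕ.+ a ]
  T-product zero    = solve 1 (λ q → (con 1 :+ q) :* con 1
    := (con 1 :+ q :* (con 1 :+ q :* con 0)) :* (con 1 :+ q :* con 0)) refl q
  T-product (suc a) = begin
    (1# + q) * (q * q * T a + y)
      ≈⟨ solve 3 (λ q t y → (con 1 :+ q) :* (q :* q :* t :+ y)
                   := q :* q :* ((con 1 :+ q) :* t) :+ (con 1 :+ q) :* y) refl q (T a) y ⟩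
    q * q * ((1# + q) * T a) + (1# + q) * y
      ≈⟨ +-congʳ (*-congˡ (T-product a)) ⟩
    q * q * (y * x) + (1# + q) * y
      ≈⟨ solve 2 (λ q x → let y = con 1 :+ q :* x in
           q :* q :* (y :* x) :+ (con 1 :+ q) :* y := (con 1 :+ q :* y) :* y) refl q x ⟩
    (1# + q * y) * y ∎
    where
    x = [ suc a ]
    y = [ suc (suc a) ]

  T-square : ∀ a → T (suc a) + q * T a ≃ [ 2 ℕ.+ a ] * [ 2 ℕ.+ a ]
  T-square a = begin
    q * q * T a + y + q * T a
      ≈⟨ solve 3 (λ q t y → q :* q :* t :+ y :+ q :* t := q :* ((con 1 :+ q) :* t) :+ y) refl q (T a) y ⟩
    q * ((1# + q) * T a) + y
      ≈⟨ +-congʳ (*-congˡ (T-product a)) ⟩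
    q * (y * x) + y
      ≈⟨ solve 2 (λ q x → let y = con 1 :+ q :* x in q :* (y :* x) :+ y := y :* y) refl q x ⟩
    y * y ∎
    where
    x = [ suc a ]
    y = [ suc (suc a) ]

  -- The defining recursion of `T` is one of the two q-Pascal rules, iterated; this is its mirror
  -- image. Both are needed for `T-palindromic`.
  T-Pascal : ∀ a → T (suc a) ≃ T a + qⁿ (suc a) * [ 2 ℕ.+ a ]
  T-Pascal zero    = trans
    (solve 1 (λ q → let y = con 1 :+ q :* (con 1 :+ q :* con 0) in
       q :* q :* con 1 :+ y := con 1 :+ q :* con 1 :* y) refl q)
    (+-congˡ (*-congʳ (sym (trans (q¹⁺ⁿ 0) (*-congˡ q⁰)))))
  T-Pascal (suc a) = begin
    q * q * T (suc a) + (1# + q * y)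
      ≈⟨ +-cong (*-congˡ (T-Pascal a)) ([1+n] (suc (suc a))) ⟩
    q * q * (T a + qⁿ (suc a) * y) + (y + qⁿ (suc (suc a)))
      ≈⟨ +-congˡ (+-congˡ (q¹⁺ⁿ (suc a))) ⟩
    q * q * (T a + r * y) + (y + q * r)
      ≈⟨ solve 4 (λ q t r y → q :* q :* (t :+ r :* y) :+ (y :+ q :* r)
                   := q :* q :* t :+ y :+ q :* r :* (con 1 :+ q :* y)) refl q (T a) r y ⟩
    T (suc a) + q * r * (1# + q * y)
      ≈⟨ +-congˡ (*-congʳ (q¹⁺ⁿ (suc a))) ⟨
    T (suc a) + qⁿ (suc (suc a)) * (1# + q * y) ∎
    where
    y = [ suc (suc a) ]
    r = qⁿ (suc a)

open ≡ hiding ([_])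

-- The ring of Laurent polynomials

infix 4 _≋_ _∼_

-- Unlike _≈_, a record type determines p and r, so that they can be inferred.
record _≋_ (p r : Laurent) : Set where
  constructor mk
  field coeff-≡ : p ≈ r
open _≋_

-- A Laurent polynomial as a linear functional: qᵉ is sent to φ e. Against an arbitrary φ the ring
-- laws follow by induction on the list without comparing exponents; coefficients are the case φ =
-- `δ z`.
⟪_⟫ : Laurent → (ℤ → ℤ) → ℤ
⟪ [] ⟫          φ = 0ℤ
⟪ (a , e) ∷ p ⟫ φ = a ℤ.* φ e ℤ.+ ⟪ p ⟫ φ

δ : ℤ → ℤ → ℤ
δ z e = if does (e ℤ.≟ z) then 1ℤ else 0ℤ

_∼_ : Laurent → Laurent → Set
p ∼ r = ∀ φ → ⟪ p ⟫ φ ≡ ⟪ r ⟫ φ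

coeff-⟪⟫ : ∀ p z → coeff p z ≡ ⟪ p ⟫ (δ z)
coeff-⟪⟫ []            z = refl
coeff-⟪⟫ ((a , e) ∷ p) z = cong₂ ℤ._+_ (scale (does (e ℤ.≟ z))) (coeff-⟪⟫ p z)
  where
  scale : ∀ b → (if b then a else 0ℤ) ≡ a ℤ.* (if b then 1ℤ else 0ℤ)
  scale true  = sym (ℤ.*-identityʳ a)
  scale false = sym (ℤ.*-zeroʳ a)

∼⇒≋ : ∀ {p r} → p ∼ r → p ≋ r
∼⇒≋ {p} {r} eq .coeff-≡ z =
  trans (coeff-⟪⟫ p z) (trans (eq (δ z)) (sym (coeff-⟪⟫ r z)))

⟪⟫-cong : ∀ p {φ ψ} → φ ≗ ψ → ⟪ p ⟫ φ ≡ ⟪ p ⟫ ψ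
⟪⟫-cong []            eq = refl
⟪⟫-cong ((a , e) ∷ p) eq = cong₂ ℤ._+_ (cong (a ℤ.*_) (eq e)) (⟪⟫-cong p eq)

⟪⟫-0 : ∀ p → ⟪ p ⟫ (λ _ → 0ℤ) ≡ 0ℤ
⟪⟫-0 []            = refl
⟪⟫-0 ((a , e) ∷ p) = cong₂ ℤ._+_ (ℤ.*-zeroʳ a) (⟪⟫-0 p)

⟪⟫-+ : ∀ p φ ψ → ⟪ p ⟫ (λ e → φ e ℤ.+ ψ e) ≡ ⟪ p ⟫ φ ℤ.+ ⟪ p ⟫ ψ
⟪⟫-+ []            φ ψ = refl
⟪⟫-+ ((a , e) ∷ p) φ ψ rewrite ⟪⟫-+ p φ ψ =
  solve 5 (λ a x y u v → a :* (x :+ y) :+ (u :+ v) := (a :* x :+ u) :+ (a :* y :+ v))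
    refl a (φ e) (ψ e) (⟪ p ⟫ φ) (⟪ p ⟫ ψ)
  where open +-*-Solver

⟪⟫-* : ∀ p a φ → ⟪ p ⟫ (λ e → a ℤ.* φ e) ≡ a ℤ.* ⟪ p ⟫ φ
⟪⟫-* []            a φ = sym (ℤ.*-zeroʳ a)
⟪⟫-* ((b , e) ∷ p) a φ rewrite ⟪⟫-* p a φ =
  solve 4 (λ a b x u → b :* (a :* x) :+ a :* u := a :* (b :* x :+ u)) refl a b (φ e) (⟪ p ⟫ φ)
  where open +-*-Solver

⟪⟫-swap : ∀ p r (φ : ℤ → ℤ → ℤ) →
          ⟪ p ⟫ (λ i → ⟪ r ⟫ (φ i)) ≡ ⟪ r ⟫ (λ j → ⟪ p ⟫ (λ i → φ i j))
⟪⟫-swap []            r φ = sym (⟪⟫-0 r)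
⟪⟫-swap ((a , e) ∷ p) r φ = begin
  a ℤ.* ⟪ r ⟫ (φ e) ℤ.+ ⟪ p ⟫ (λ i → ⟪ r ⟫ (φ i))
    ≡⟨ cong₂ ℤ._+_ (sym (⟪⟫-* r a (φ e))) (⟪⟫-swap p r φ) ⟩
  ⟪ r ⟫ (λ j → a ℤ.* φ e j) ℤ.+ ⟪ r ⟫ (λ j → ⟪ p ⟫ (λ i → φ i j))
    ≡⟨ ⟪⟫-+ r _ _ ⟨
  ⟪ r ⟫ (λ j → a ℤ.* φ e j ℤ.+ ⟪ p ⟫ (λ i → φ i j)) ∎
  where open ≡-Reasoning

⟪⟫-⊕ : ∀ p r φ → ⟪ p ⊕ r ⟫ φ ≡ ⟪ p ⟫ φ ℤ.+ ⟪ r ⟫ φ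
⟪⟫-⊕ []            r φ = sym (ℤ.+-identityˡ _)
⟪⟫-⊕ ((a , e) ∷ p) r φ =
  trans (cong (λ u → a ℤ.* φ e ℤ.+ u) (⟪⟫-⊕ p r φ)) (sym (ℤ.+-assoc (a ℤ.* φ e) (⟪ p ⟫ φ) (⟪ r ⟫ φ)))

⟪⟫-map : ∀ (f : ℤ → ℤ) k r φ → ⟪ map (λ (b , j) → k ℤ.* b , f j) r ⟫ φ ≡ k ℤ.* ⟪ r ⟫ (λ j → φ (f j))
⟪⟫-map f k []            φ = sym (ℤ.*-zeroʳ k)
⟪⟫-map f k ((b , j) ∷ r) φ rewrite ⟪⟫-map f k r φ =
  solve 4 (λ k b x u → k :* b :* x :+ k :* u := k :* (b :* x :+ u)) refl
    k b (φ (f j)) (⟪ r ⟫ (λ j → φ (f j)))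
  where open +-*-Solver

⟪⟫-⊗ : ∀ p r φ → ⟪ p ⊗ r ⟫ φ ≡ ⟪ p ⟫ (λ i → ⟪ r ⟫ (λ j → φ (i ℤ.+ j)))
⟪⟫-⊗ []            r φ = refl
⟪⟫-⊗ ((a , e) ∷ p) r φ =
  trans (⟪⟫-⊕ (map (λ (b , j) → a ℤ.* b , e ℤ.+ j) r) (p ⊗ r) φ)
        (cong₂ ℤ._+_ (⟪⟫-map (λ j → e ℤ.+ j) a r φ) (⟪⟫-⊗ p r φ))

infix 8 ⊖′_
-- Chosen so that `p ⊖ r` is `p ⊕ ⊖′ r` by definition.
⊖′_ : Laurent → Laurent
⊖′ p = map (λ (a , e) → ℤ.- a , e) p

⟪⟫-⊖′ : ∀ p φ → ⟪ ⊖′ p ⟫ φ ≡ ℤ.- ⟪ p ⟫ φ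
⟪⟫-⊖′ []            φ = refl
⟪⟫-⊖′ ((a , e) ∷ p) φ rewrite ⟪⟫-⊖′ p φ =
  solve 3 (λ a x u → (:- a) :* x :+ (:- u) := :- (a :* x :+ u)) refl a (φ e) (⟪ p ⟫ φ)
  where open +-*-Solver

⊗-comm∼ : ∀ p r → p ⊗ r ∼ r ⊗ p
⊗-comm∼ p r φ = begin
  ⟪ p ⊗ r ⟫ φ                              ≡⟨ ⟪⟫-⊗ p r φ ⟩
  ⟪ p ⟫ (λ i → ⟪ r ⟫ (λ j → φ (i ℤ.+ j)))  ≡⟨ ⟪⟫-swap p r _ ⟩
  ⟪ r ⟫ (λ j → ⟪ p ⟫ (λ i → φ (i ℤ.+ j)))
    ≡⟨ ⟪⟫-cong r (λ j → ⟪⟫-cong p λ i → cong φ (ℤ.+-comm i j)) ⟩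
  ⟪ r ⟫ (λ j → ⟪ p ⟫ (λ i → φ (j ℤ.+ i)))  ≡⟨ ⟪⟫-⊗ r p φ ⟨
  ⟪ r ⊗ p ⟫ φ                              ∎
  where open ≡-Reasoning

⊗-assoc∼ : ∀ p r s → (p ⊗ r) ⊗ s ∼ p ⊗ (r ⊗ s)
⊗-assoc∼ p r s φ = begin
  ⟪ p ⊗ r ⊗ s ⟫ φ
    ≡⟨ ⟪⟫-⊗ (p ⊗ r) s φ ⟩
  ⟪ p ⊗ r ⟫ (λ i → ⟪ s ⟫ (λ j → φ (i ℤ.+ j)))
    ≡⟨ ⟪⟫-⊗ p r _ ⟩
  ⟪ p ⟫ (λ i → ⟪ r ⟫ (λ k → ⟪ s ⟫ (λ j → φ (i ℤ.+ k ℤ.+ j))))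
    ≡⟨ ⟪⟫-cong p (λ i → ⟪⟫-cong r λ k → ⟪⟫-cong s λ j → cong φ (ℤ.+-assoc i k j)) ⟩
  ⟪ p ⟫ (λ i → ⟪ r ⟫ (λ k → ⟪ s ⟫ (λ j → φ (i ℤ.+ (k ℤ.+ j)))))
    ≡⟨ ⟪⟫-cong p (λ i → ⟪⟫-⊗ r s _) ⟨
  ⟪ p ⟫ (λ i → ⟪ r ⊗ s ⟫ (λ j → φ (i ℤ.+ j)))
    ≡⟨ ⟪⟫-⊗ p (r ⊗ s) φ ⟨
  ⟪ p ⊗ (r ⊗ s) ⟫ φ ∎
  where open ≡-Reasoning

⊗-identityˡ∼ : ∀ p → 1L ⊗ p ∼ p
⊗-identityˡ∼ p φ = begin
  ⟪ 1L ⊗ p ⟫ φ                                ≡⟨ ⟪⟫-⊗ 1L p φ ⟩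
  1ℤ ℤ.* ⟪ p ⟫ (λ j → φ (0ℤ ℤ.+ j)) ℤ.+ 0ℤ    ≡⟨ ℤ.+-identityʳ _ ⟩
  1ℤ ℤ.* ⟪ p ⟫ (λ j → φ (0ℤ ℤ.+ j))           ≡⟨ ℤ.*-identityˡ _ ⟩
  ⟪ p ⟫ (λ j → φ (0ℤ ℤ.+ j))                  ≡⟨ ⟪⟫-cong p (λ j → cong φ (ℤ.+-identityˡ j)) ⟩
  ⟪ p ⟫ φ                                     ∎
  where open ≡-Reasoning

⊗-distribˡ∼ : ∀ p r s → p ⊗ (r ⊕ s) ∼ p ⊗ r ⊕ p ⊗ s
⊗-distribˡ∼ p r s φ = begin
  ⟪ p ⊗ (r ⊕ s) ⟫ φ
    ≡⟨ ⟪⟫-⊗ p (r ⊕ s) φ ⟩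
  ⟪ p ⟫ (λ i → ⟪ r ⊕ s ⟫ (λ j → φ (i ℤ.+ j)))
    ≡⟨ ⟪⟫-cong p (λ i → ⟪⟫-⊕ r s _) ⟩
  ⟪ p ⟫ (λ i → ⟪ r ⟫ (λ j → φ (i ℤ.+ j)) ℤ.+ ⟪ s ⟫ (λ j → φ (i ℤ.+ j)))
    ≡⟨ ⟪⟫-+ p _ _ ⟩
  ⟪ p ⟫ (λ i → ⟪ r ⟫ (λ j → φ (i ℤ.+ j))) ℤ.+ ⟪ p ⟫ (λ i → ⟪ s ⟫ (λ j → φ (i ℤ.+ j)))
    ≡⟨ cong₂ ℤ._+_ (⟪⟫-⊗ p r φ) (⟪⟫-⊗ p s φ) ⟨
  ⟪ p ⊗ r ⟫ φ ℤ.+ ⟪ p ⊗ s ⟫ φ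
    ≡⟨ ⟪⟫-⊕ (p ⊗ r) (p ⊗ s) φ ⟨
  ⟪ p ⊗ r ⊕ p ⊗ s ⟫ φ ∎
  where open ≡-Reasoning

-- Here `r` enters only through its coefficients, so `⊗` respects `≋` in its right factor;
-- commutativity carries this over to the left one.
coeff-⊗ : ∀ p r z → coeff (p ⊗ r) z ≡ ⟪ p ⟫ (λ i → coeff r (z ℤ.- i))
coeff-⊗ p r z = begin
  coeff (p ⊗ r) z                            ≡⟨ coeff-⟪⟫ (p ⊗ r) z ⟩
  ⟪ p ⊗ r ⟫ (δ z)                            ≡⟨ ⟪⟫-⊗ p r (δ z) ⟩
  ⟪ p ⟫ (λ i → ⟪ r ⟫ (λ j → δ z (i ℤ.+ j)))
    ≡⟨ ⟪⟫-cong p (λ i → ⟪⟫-cong r λ j → shift i j) ⟩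
  ⟪ p ⟫ (λ i → ⟪ r ⟫ (δ (z ℤ.- i)))          ≡⟨ ⟪⟫-cong p (λ i → coeff-⟪⟫ r (z ℤ.- i)) ⟨
  ⟪ p ⟫ (λ i → coeff r (z ℤ.- i))            ∎
  where
  open ≡-Reasoning
  shift : ∀ i j → δ z (i ℤ.+ j) ≡ δ (z ℤ.- i) j
  shift i j = cong (λ b → if b then 1ℤ else 0ℤ) (does-⇔ (mk⇔
    (λ eq → trans (solve 2 (λ i j → j := i :+ j :- i) refl i j) (cong (λ e → e ℤ.- i) eq))
    (λ eq → trans (cong (λ e → i ℤ.+ e) eq) (solve 2 (λ i z → i :+ (z :- i) := z) refl i z)))
    (i ℤ.+ j ℤ.≟ z) (j ℤ.≟ z ℤ.- i))
    where open +-*-Solver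

≋-refl : ∀ {p} → p ≋ p
≋-refl .coeff-≡ z = refl

≋-sym : ∀ {p r} → p ≋ r → r ≋ p
≋-sym eq .coeff-≡ z = sym (eq .coeff-≡ z)

≋-trans : ∀ {p r s} → p ≋ r → r ≋ s → p ≋ s
≋-trans eq eq′ .coeff-≡ z = trans (eq .coeff-≡ z) (eq′ .coeff-≡ z)

coeff-⊕ : ∀ p r z → coeff (p ⊕ r) z ≡ coeff p z ℤ.+ coeff r z
coeff-⊕ p r z rewrite coeff-⟪⟫ (p ⊕ r) z | coeff-⟪⟫ p z | coeff-⟪⟫ r z = ⟪⟫-⊕ p r (δ z)

coeff-⊖′ : ∀ p z → coeff (⊖′ p) z ≡ ℤ.- coeff p z
coeff-⊖′ p z rewrite coeff-⟪⟫ (⊖′ p) z | coeff-⟪⟫ p z = ⟪⟫-⊖′ p (δ z)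

⊕-cong : ∀ {p p′ r r′} → p ≋ p′ → r ≋ r′ → p ⊕ r ≋ p′ ⊕ r′
⊕-cong {p} {p′} {r} {r′} eq eq′ .coeff-≡ z rewrite coeff-⊕ p r z | coeff-⊕ p′ r′ z =
  cong₂ ℤ._+_ (eq .coeff-≡ z) (eq′ .coeff-≡ z)

⊖′-cong : ∀ {p r} → p ≋ r → ⊖′ p ≋ ⊖′ r
⊖′-cong {p} {r} eq .coeff-≡ z rewrite coeff-⊖′ p z | coeff-⊖′ r z = cong ℤ.-_ (eq .coeff-≡ z)

⊗-congˡ : ∀ p {r r′} → r ≋ r′ → p ⊗ r ≋ p ⊗ r′
⊗-congˡ p {r} {r′} eq .coeff-≡ z rewrite coeff-⊗ p r z | coeff-⊗ p r′ z =
  ⟪⟫-cong p λ i → eq .coeff-≡ (z ℤ.- i)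

⊗-comm : ∀ p r → p ⊗ r ≋ r ⊗ p
⊗-comm p r = ∼⇒≋ (⊗-comm∼ p r)

⊗-cong : ∀ {p p′ r r′} → p ≋ p′ → r ≋ r′ → p ⊗ r ≋ p′ ⊗ r′
⊗-cong {p} {p′} {r} {r′} eq eq′ =
  ≋-trans (⊗-congˡ p eq′) (≋-trans (⊗-comm p r′) (≋-trans (⊗-congˡ r′ eq) (⊗-comm r′ p′)))

⊕-comm : ∀ p r → p ⊕ r ≋ r ⊕ p
⊕-comm p r .coeff-≡ z rewrite coeff-⊕ p r z | coeff-⊕ r p z = ℤ.+-comm (coeff p z) (coeff r z)

⊖′-inverseˡ : ∀ p → ⊖′ p ⊕ p ≋ 0L
⊖′-inverseˡ p .coeff-≡ z rewrite coeff-⊕ (⊖′ p) p z | coeff-⊖′ p z = ℤ.+-inverseˡ (coeff p z)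

laurentRing : CommutativeRing 0ℓ 0ℓ
laurentRing = record
  { Carrier = Laurent ; _≈_ = _≋_ ; _+_ = _⊕_ ; _*_ = _⊗_ ; -_ = ⊖′_ ; 0# = 0L ; 1# = 1L
  ; isCommutativeRing = record
    { isRing = record
      { +-isAbelianGroup = record
        { isGroup = record
          { isMonoid = record
            { isSemigroup = record
              { isMagma = record
                { isEquivalence = record { refl = ≋-refl ; sym = ≋-sym ; trans = ≋-trans }
                ; ∙-cong = ⊕-cong }
              ; assoc = λ p r s → ≡⇒≋ (List.++-assoc p r s) }
            ; identity = (λ _ → ≋-refl) , λ p → ≡⇒≋ (List.++-identityʳ p) }
          ; inverse = ⊖′-inverseˡ , λ p → ≋-trans (⊕-comm p (⊖′ p)) (⊖′-inverseˡ p)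
          ; ⁻¹-cong = ⊖′-cong }
        ; comm = ⊕-comm }
      ; *-cong = ⊗-cong
      ; *-assoc = λ p r s → ∼⇒≋ (⊗-assoc∼ p r s)
      ; *-identity = identityˡ , λ p → ≋-trans (⊗-comm p 1L) (identityˡ p)
      ; distrib = distribˡ , λ p r s →
          ≋-trans (⊗-comm (r ⊕ s) p)
            (≋-trans (distribˡ p r s) (⊕-cong (⊗-comm p r) (⊗-comm p s))) }
    ; *-comm = ⊗-comm } }
  where
  ≡⇒≋ : ∀ {p r} → p ≡ r → p ≋ r
  ≡⇒≋ refl = ≋-refl
  identityˡ : ∀ p → 1L ⊗ p ≋ p
  identityˡ p = ∼⇒≋ (⊗-identityˡ∼ p)
  distribˡ : ∀ p r s → p ⊗ (r ⊕ s) ≋ p ⊗ r ⊕ p ⊗ s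
  distribˡ p r s = ∼⇒≋ (⊗-distribˡ∼ p r s)

laurentSemiring : CommutativeSemiring 0ℓ 0ℓ
laurentSemiring = CommutativeRing.commutativeSemiring laurentRing

module R = CommutativeRing laurentRing
module ≋-Reasoning = Relation.Binary.Reasoning.Setoid R.setoid
module LaurentSolver = Algebra.Solver.Ring.NaturalCoefficients.Default laurentSemiring

open Sums laurentSemiring
open QIntegers laurentSemiring q (λ n → q^ (+ n)) ≋-refl (λ _ → ≋-refl)

-- Exact division

Positive : ℤ × ℤ → Set
Positive (a , e) = 0ℤ ℤ.< a × 0ℤ ℤ.≤ e

StrictlyPositive : ℤ × ℤ → Set
StrictlyPositive (a , e) = 0ℤ ℤ.< a × 0ℤ ℤ.< e

⊗-All⁺ : ∀ {P Q S : ℤ × ℤ → Set} →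
         (∀ {a i b j} → P (a , i) → Q (b , j) → S (a ℤ.* b , i ℤ.+ j)) →
         ∀ {p r} → All P p → All Q r → All S (p ⊗ r)
⊗-All⁺ f []         Qr = []
⊗-All⁺ f (Px ∷ Pp) Qr = All.++⁺ (All.map⁺ (All.map (f Px) Qr)) (⊗-All⁺ f Pp Qr)

0<-* : ∀ {a b} → 0ℤ ℤ.< a → 0ℤ ℤ.< b → 0ℤ ℤ.< a ℤ.* b
0<-* {+ suc a} {+ suc b} _ _ = +<+ (s≤s z≤n)
0<-* {+ zero}          (+<+ ()) _
0<-* {+ suc a} {+ zero} _ (+<+ ())

positive-⊗ : ∀ {p r} → All Positive p → All Positive r → All Positive (p ⊗ r)
positive-⊗ = ⊗-All⁺ λ (0<a , 0≤i) (0<b , 0≤j) → 0<-* 0<a 0<b , ℤ.+-mono-≤ 0≤i 0≤j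

strictlyPositive-⊗ : ∀ {p r} → All StrictlyPositive p → All Positive r → All StrictlyPositive (p ⊗ r)
strictlyPositive-⊗ = ⊗-All⁺ λ (0<a , 0<i) (0<b , 0≤j) → 0<-* 0<a 0<b , ℤ.+-mono-<-≤ 0<i 0≤j

positive : ∀ {p} → All StrictlyPositive p → All Positive p
positive = All.map λ (0<a , 0<e) → 0<a , ℤ.<⇒≤ 0<e

Monic : Laurent → Set
Monic p = ∃[ p′ ] p ≡ (1ℤ , 0ℤ) ∷ p′ × All StrictlyPositive p′

monic-positive : ∀ {p} → Monic p → All Positive p
monic-positive (p′ , refl , p′>0) = (+<+ (s≤s z≤n) , ℤ.≤-refl) ∷ positive p′>0

monic-1 : Monic 1L
monic-1 = [] , refl , []

monic-⊗ : ∀ {p r} → Monic p → Monic r → Monic (p ⊗ r)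
monic-⊗ m@(p′ , refl , p′>0) m′@(r′ , refl , r′>0) = _ , refl , All.++⁺
  (All.map⁺ (All.map (λ (0<b , 0<j) → 0<-* {1ℤ} (+<+ (s≤s z≤n)) 0<b , ℤ.+-mono-≤-< (ℤ.≤-refl {0ℤ}) 0<j) r′>0))
  (strictlyPositive-⊗ p′>0 (monic-positive m′))

coeff-outside : ∀ {P : ℤ × ℤ → Set} {p z} → All P p → (∀ {a} → ¬ P (a , z)) → coeff p z ≡ 0ℤ
coeff-outside             []         ¬P = refl
coeff-outside {P} {(a , e) ∷ p} {z} (Px ∷ Pp) ¬P with e ℤ.≟ z
... | yes refl = contradiction Px ¬P
... | no  e≢z  = trans (ℤ.+-identityˡ _) (coeff-outside Pp ¬P)

⟪⟫-zero : ∀ {P : ℤ × ℤ → Set} {p φ} → All P p → (∀ {a e} → P (a , e) → φ e ≡ 0ℤ) → ⟪ p ⟫ φ ≡ 0ℤ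
⟪⟫-zero []         φ≡0 = refl
⟪⟫-zero {p = (a , e) ∷ p} (Px ∷ Pp) φ≡0 =
  cong₂ ℤ._+_ (trans (cong (a ℤ.*_) (φ≡0 Px)) (ℤ.*-zeroʳ a)) (⟪⟫-zero Pp φ≡0)

coeff-lowest : ∀ {b′} d i → All (λ (a , e) → 0ℤ ℤ.< e) b′ → (∀ {z} → z ℤ.< i → coeff d z ≡ 0ℤ) →
               coeff (((1ℤ , 0ℤ) ∷ b′) ⊗ d) i ≡ coeff d i
coeff-lowest {b′} d i b′>0 low = begin
  coeff (((1ℤ , 0ℤ) ∷ b′) ⊗ d) i
    ≡⟨ coeff-⊗ ((1ℤ , 0ℤ) ∷ b′) d i ⟩
  1ℤ ℤ.* coeff d (i ℤ.- 0ℤ) ℤ.+ ⟪ b′ ⟫ (λ e → coeff d (i ℤ.- e))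
    ≡⟨ cong₂ ℤ._+_ (trans (ℤ.*-identityˡ _) (cong (coeff d) (ℤ.+-identityʳ i)))
         (⟪⟫-zero b′>0 λ {_} {e} 0<e → low (subst (i ℤ.- e ℤ.<_) (ℤ.+-identityʳ i)
           (ℤ.+-monoʳ-< i (ℤ.neg-mono-< 0<e)))) ⟩
  coeff d i ℤ.+ 0ℤ
    ≡⟨ ℤ.+-identityʳ _ ⟩
  coeff d i ∎
  where open ≡-Reasoning

coeff-monomial-≡ : ∀ a e → coeff (monomial a e) e ≡ a
coeff-monomial-≡ a e rewrite dec-true (e ℤ.≟ e) refl = ℤ.+-identityʳ a

coeff-monomial-≢ : ∀ a {e z} → e ≢ z → coeff (monomial a e) z ≡ 0ℤ
coeff-monomial-≢ a {e} {z} e≢z rewrite dec-false (e ℤ.≟ z) e≢z = refl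

-- The invariant: `d` is the part of the quotient still to be found, supported in degrees i, ..., i
-- + n - 1. Since `b` has constant term 1 and otherwise positive degrees, `a` and `d` have the same
-- coefficient at i, so passing from `d` to `d ⊖ t` keeps the relation and shrinks the support.
divide-correct : ∀ n i {a b b′ d} → All (λ (a , e) → 0ℤ ℤ.< e) b′ → b ≋ (1ℤ , 0ℤ) ∷ b′ → a ≋ b ⊗ d →
                 (∀ {z} → z ℤ.< + i → coeff d z ≡ 0ℤ) → (∀ {z} → + (i ℕ.+ n) ℤ.≤ z → coeff d z ≡ 0ℤ) →
                 divide n i a b ≋ d
divide-correct zero i {d = d} b′>0 b≋ a≋ low high .coeff-≡ z with z ℤ.<? + i
... | yes z<i = sym (low z<i)
... | no  z≮i = sym (high (subst (λ m → + m ℤ.≤ z) (sym (ℕ.+-identityʳ i)) (ℤ.≮⇒≥ z≮i)))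
divide-correct (suc n) i {a} {b} {b′} {d} b′>0 b≋ a≋ low high = begin
  t ⊕ divide n (suc i) (a ⊖ t ⊗ b) b
    ≈⟨ R.+-congˡ {t} (divide-correct n (suc i) b′>0 b≋ a′≋ low′ high′) ⟩
  t ⊕ (d ⊖ t)
    ≈⟨ R.+-congˡ {t} (R.+-comm d (⊖′ t)) ⟩
  t ⊕ (⊖′ t ⊕ d)
    ≈⟨ R.+-assoc t (⊖′ t) d ⟨
  t ⊕ ⊖′ t ⊕ d
    ≈⟨ R.+-congʳ {d} (R.-‿inverseʳ t) ⟩
  d ∎
  where
  open ≋-Reasoning
  open Algebra.Properties.Ring R.ring using (-‿distribʳ-*)
  t = monomial (coeff a (+ i)) (+ i)
  aᵢ≡dᵢ : coeff a (+ i) ≡ coeff d (+ i)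
  aᵢ≡dᵢ = trans (coeff-≡ (≋-trans a≋ (R.*-congʳ {d} b≋)) (+ i)) (coeff-lowest d (+ i) b′>0 low)
  a′≋ : a ⊖ t ⊗ b ≋ b ⊗ (d ⊖ t)
  a′≋ = begin
    a ⊕ ⊖′ (t ⊗ b)          ≈⟨ ⊕-cong a≋ (⊖′-cong (⊗-comm t b)) ⟩
    b ⊗ d ⊕ ⊖′ (b ⊗ t)      ≈⟨ R.+-congˡ {b ⊗ d} (-‿distribʳ-* b t) ⟩
    b ⊗ d ⊕ b ⊗ ⊖′ t        ≈⟨ R.distribˡ b d (⊖′ t) ⟨
    b ⊗ (d ⊕ ⊖′ t)          ∎
  coeff-d′ : ∀ z → coeff (d ⊖ t) z ≡ coeff d z ℤ.- coeff t z
  coeff-d′ z = trans (coeff-⊕ d (⊖′ t) z) (cong (λ x → coeff d z ℤ.+ x) (coeff-⊖′ t z))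
  at-i : coeff (d ⊖ t) (+ i) ≡ 0ℤ
  at-i = trans (coeff-d′ (+ i)) (trans
    (cong (λ x → coeff d (+ i) ℤ.- x) (trans (coeff-monomial-≡ _ (+ i)) aᵢ≡dᵢ)) (ℤ.+-inverseʳ (coeff d (+ i))))
  elsewhere : ∀ {z} → + i ≢ z → coeff d z ≡ 0ℤ → coeff (d ⊖ t) z ≡ 0ℤ
  elsewhere {z} i≢z d≡0 = trans (coeff-d′ z) (cong₂ ℤ._-_ d≡0 (coeff-monomial-≢ _ i≢z))
  low′ : ∀ {z} → z ℤ.< + suc i → coeff (d ⊖ t) z ≡ 0ℤ
  low′ {z} z<1+i with ℤ.<-cmp z (+ i)
  ... | tri< z<i z≢i _ = elsewhere (z≢i ∘ sym) (low z<i)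
  ... | tri≈ _ refl _  = at-i
  ... | tri> _ _ i<z   = contradiction (ℤ.<-≤-trans z<1+i (ℤ.i<j⇒suc[i]≤j i<z)) (ℤ.<-irrefl refl)
  high′ : ∀ {z} → + (suc i ℕ.+ n) ℤ.≤ z → coeff (d ⊖ t) z ≡ 0ℤ
  high′ {z} i+n<z = elsewhere
    (λ { refl → contradiction (ℤ.drop‿+≤+ i+n<z) (ℕ.<⇒≱ (s≤s (ℕ.m≤m+n i n))) })
    (high (subst (λ m → + m ℤ.≤ z) (sym (ℕ.+-suc i n)) i+n<z))

÷-correct : ∀ {a b b′ d} → All (λ (a , e) → 0ℤ ℤ.< e) b′ → b ≋ (1ℤ , 0ℤ) ∷ b′ → a ≋ b ⊗ d →
            All (λ (_ , e) → 0ℤ ℤ.≤ e × e ℤ.≤ + degreeBound a) d → a ÷ b ≋ d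
÷-correct b′>0 b≋ a≋ bounds = divide-correct _ 0 b′>0 b≋ a≋
  (λ z<0 → coeff-outside bounds λ (0≤z , _) → ℤ.<⇒≱ z<0 0≤z)
  (λ D<z → coeff-outside bounds λ (_ , z≤D) → ℤ.<⇒≱ (ℤ.<-≤-trans (+<+ (ℕ.n<1+n _)) D<z) z≤D)

coeff-beyond-degree : ∀ p {z} → degreeBound p ℕ.< ℤ.∣ z ∣ → coeff p z ≡ 0ℤ
coeff-beyond-degree []            D<z = refl
coeff-beyond-degree ((a , e) ∷ p) {z} D<z with e ℤ.≟ z
... | yes refl = contradiction (ℕ.<-≤-trans D<z (ℕ.m≤m⊔n ℤ.∣ e ∣ (degreeBound p))) (ℕ.<-irrefl refl)
... | no  _    = trans (ℤ.+-identityˡ _)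
  (coeff-beyond-degree p (ℕ.≤-<-trans (ℕ.m≤n⊔m ℤ.∣ e ∣ (degreeBound p)) D<z))

coeff-positive : ∀ {p} → All Positive p → ∀ z → 0ℤ ℤ.≤ coeff p z
coeff-positive []                        z = ℤ.≤-refl
coeff-positive {(a , e) ∷ p} ((0<a , _) ∷ p>0) z with e ℤ.≟ z
... | yes _ = ℤ.+-mono-≤ (ℤ.<⇒≤ 0<a) (coeff-positive p>0 z)
... | no  _ = ℤ.+-mono-≤ (ℤ.≤-refl {0ℤ}) (coeff-positive p>0 z)

-- With all coefficients positive, a listed term cannot be cancelled by the others.
coeff-∈ : ∀ {p a e} → All Positive p → (a , e) ∈ p → 0ℤ ℤ.< coeff p e
coeff-∈ {(a , e) ∷ p} ((0<a , _) ∷ p>0) (here refl) rewrite dec-true (e ℤ.≟ e) refl =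
  ℤ.+-mono-<-≤ 0<a (coeff-positive p>0 e)
coeff-∈ {(b , i) ∷ p} {e = e} ((0<b , _) ∷ p>0) (there a∈p) with i ℤ.≟ e
... | yes _ = ℤ.+-mono-< 0<b (coeff-∈ p>0 a∈p)
... | no  _ = ℤ.+-mono-≤-< (ℤ.≤-refl {0ℤ}) (coeff-∈ p>0 a∈p)

-- No cancellation occurs in a product of polynomials with positive coefficients, so the degree of the
-- quotient does not exceed that of the dividend.
÷-positive : ∀ {a b b′ d} → Monic b′ → b ≋ b′ → a ≋ b ⊗ d → All Positive d → a ÷ b ≋ d
÷-positive {a} {b} {b′} {d} m@(p , refl , p>0) b≋ a≋ d>0 =
  ÷-correct (All.map proj₂ p>0) b≋ a≋ (All.tabulate bounds)
  where
  bounds : ∀ {x} → x ∈ d → 0ℤ ℤ.≤ proj₂ x × proj₂ x ℤ.≤ + degreeBound a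
  bounds {x , e} x∈d = 0≤e , subst (ℤ._≤ + degreeBound a) (ℤ.0≤i⇒+∣i∣≡i 0≤e) (+≤+ (ℕ.≮⇒≥ λ D<e →
    ℤ.<-irrefl (sym (coeff-beyond-degree a D<e)) (subst (0ℤ ℤ.<_) (sym (coeff-≡ a≋b′d e)) 0<coeff)))
    where
    0≤e = proj₂ (All.lookup d>0 x∈d)
    a≋b′d : a ≋ b′ ⊗ d
    a≋b′d = ≋-trans a≋ (R.*-congʳ {d} b≋)
    -- The term 1 at the head of `b′` makes a copy of `d` the initial segment of `b′ ⊗ d`.
    0<coeff : 0ℤ ℤ.< coeff (b′ ⊗ d) e
    0<coeff = coeff-∈ (positive-⊗ (monic-positive m) d>0) (∈.∈-++⁺ˡ
      (subst (λ i → (1ℤ ℤ.* x , i) ∈ map shift d) (ℤ.+-identityˡ e) (∈.∈-map⁺ shift x∈d)))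
      where
      shift : ℤ × ℤ → ℤ × ℤ
      shift (b , j) = 1ℤ ℤ.* b , 0ℤ ℤ.+ j

-- Gaussian binomial coefficients

[]-bounds : ∀ n → All (λ (_ , e) → 0ℤ ℤ.≤ e × e ℤ.≤ + n) [ n ]
[]-bounds zero    = []
[]-bounds (suc n) = (+≤+ z≤n , +≤+ z≤n) ∷ All.++⁺
  (All.map⁺ (All.map (λ (0≤e , e≤n) → ℤ.+-mono-≤ (+≤+ z≤n) 0≤e , ℤ.+-monoʳ-≤ 1ℤ e≤n) ([]-bounds n))) []

-- The divisor has a negative coefficient, so `÷-positive` does not apply; instead the degree bound
-- of the dividend is computed and compared with the exponents in `[ i ]`.
[]-quotient : ∀ i → (1L ⊖ q^ (+ i)) ÷ (1L ⊖ q) ≋ [ i ]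
[]-quotient i = ÷-correct (+<+ (s≤s z≤n) ∷ []) ≋-refl eq
  (All.map (λ (0≤e , e≤i) → 0≤e , subst (λ m → _ ℤ.≤ + m) (sym (ℕ.⊔-identityʳ i)) e≤i) ([]-bounds i))
  where
  open ≋-Reasoning
  open Algebra.Properties.Ring R.ring using (-‿distribˡ-*)
  open LaurentSolver
  x = [ i ]
  qⁱ = q^ (+ i)
  eq : 1L ⊖ qⁱ ≋ (1L ⊖ q) ⊗ x
  eq = begin
    1L ⊕ ⊖′ qⁱ
      ≈⟨ R.+-congˡ {1L} (≋-trans (≋-sym (R.+-identityˡ (⊖′ qⁱ)))
           (R.+-congʳ {⊖′ qⁱ} (≋-sym (R.-‿inverseʳ (q ⊗ x))))) ⟩
    1L ⊕ (q ⊗ x ⊕ ⊖′ (q ⊗ x) ⊕ ⊖′ qⁱ)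
      ≈⟨ solve 4 (λ a b c d → a :+ (b :+ c :+ d) := a :+ b :+ (c :+ d)) ≋-refl 1L (q ⊗ x) (⊖′ (q ⊗ x)) (⊖′ qⁱ) ⟩
    (1L ⊕ q ⊗ x) ⊕ (⊖′ (q ⊗ x) ⊕ ⊖′ qⁱ)
      ≈⟨ R.+-congʳ {⊖′ (q ⊗ x) ⊕ ⊖′ qⁱ} ([1+n] i) ⟩
    (x ⊕ qⁱ) ⊕ (⊖′ (q ⊗ x) ⊕ ⊖′ qⁱ)
      ≈⟨ solve 4 (λ a b c d → a :+ b :+ (c :+ d) := a :+ c :+ (b :+ d)) ≋-refl x qⁱ (⊖′ (q ⊗ x)) (⊖′ qⁱ) ⟩
    x ⊕ ⊖′ (q ⊗ x) ⊕ (qⁱ ⊕ ⊖′ qⁱ)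
      ≈⟨ ⊕-cong (⊕-cong (≋-sym (R.*-identityˡ x)) (-‿distribˡ-* q x)) (R.-‿inverseʳ qⁱ) ⟩
    1L ⊗ x ⊕ ⊖′ q ⊗ x ⊕ 0L
      ≈⟨ R.+-identityʳ _ ⟩
    1L ⊗ x ⊕ ⊖′ q ⊗ x
      ≈⟨ R.distribʳ x 1L (⊖′ q) ⟨
    (1L ⊕ ⊖′ q) ⊗ x ∎

_!q : ℕ → Laurent
zero  !q = 1L
suc m !q = m !q ⊗ [ suc m ]

∏-∷ʳ : {A : Set} (xs : List A) (y : A) (t : A → Laurent) → ∏ (xs ++ y ∷ []) t ≋ ∏ xs t ⊗ t y
∏-∷ʳ []       y t = ⊗-comm (t y) 1L
∏-∷ʳ (x ∷ xs) y t = ≋-trans (R.*-congˡ {t x} (∏-∷ʳ xs y t)) (≋-sym (R.*-assoc (t x) _ _))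

[1⋯1+n] : ∀ m → [1⋯ suc m ] ≡ [1⋯ m ] ++ suc m ∷ []
[1⋯1+n] m = trans (cong (map suc) (sym (List.upTo-∷ʳ m))) (List.map-++ suc (upTo m) (m ∷ []))

[]!≋!q : ∀ m → [ m ]! ≋ m !q
[]!≋!q zero    = ≋-refl
[]!≋!q (suc m) = begin
  ∏ [1⋯ suc m ] factor             ≡⟨ cong (λ is → ∏ is factor) ([1⋯1+n] m) ⟩
  ∏ ([1⋯ m ] ++ suc m ∷ []) factor  ≈⟨ ∏-∷ʳ [1⋯ m ] (suc m) factor ⟩
  [ m ]! ⊗ factor (suc m)           ≈⟨ ⊗-cong ([]!≋!q m) ([]-quotient (suc m)) ⟩
  m !q ⊗ [ suc m ]                  ∎
  where
  open ≋-Reasoning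
  factor : ℕ → Laurent
  factor i = (1L ⊖ q^ (+ i)) ÷ (1L ⊖ q)

[]-positive : ∀ n → All StrictlyPositive (q ⊗ [ n ])
[]-monic : ∀ n → Monic [ suc n ]

[]-monic n = q ⊗ [ n ] , refl , []-positive n

[]-positive zero    = []
[]-positive (suc n) = strictlyPositive-⊗ {p = q}
  ((+<+ (s≤s z≤n) , +<+ (s≤s z≤n)) ∷ []) (monic-positive ([]-monic n))

!q-monic : ∀ m → Monic (m !q)
!q-monic zero    = monic-1
!q-monic (suc m) = monic-⊗ (!q-monic m) ([]-monic m)

T-positive : ∀ a → All Positive (T a)
T-positive zero    = monic-positive monic-1
T-positive (suc a) = All.++⁺ (positive-⊗ (positive-⊗ q-positive q-positive) (T-positive a))
                             (monic-positive ([]-monic (suc a)))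
  where
  q-positive : All Positive q
  q-positive = (+<+ (s≤s z≤n) , +≤+ z≤n) ∷ []

-- Writing m as k + j avoids truncated subtraction, and a product identity with a positive candidate
-- `d` is all that exact division asks for.
binom-correct : ∀ {m} k j {d} → m ≡ k ℕ.+ j → m !q ≋ k !q ⊗ j !q ⊗ d → All Positive d → binom m k ≋ d
binom-correct k j {d} refl eq d>0
  rewrite dec-true (k ℕ.≤? k ℕ.+ j) (ℕ.m≤m+n k j) | ℕ.m+n∸m≡n k j =
  ÷-positive (monic-⊗ (!q-monic k) (!q-monic j)) k!j!
    (≋-trans ([]!≋!q (k ℕ.+ j)) (≋-trans eq (R.*-congʳ {d} (≋-sym k!j!)))) d>0
  where
  k!j! : [ k ]! ⊗ [ j ]! ≋ k !q ⊗ j !q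
  k!j! = ⊗-cong ([]!≋!q k) ([]!≋!q j)

binom-zero : ∀ {m k} → m ℕ.< k → binom m k ≋ 0L
binom-zero {m} {k} m<k rewrite dec-false (k ℕ.≤? m) (ℕ.<⇒≱ m<k) = ≋-refl

binom-m-0 : ∀ m → binom m 0 ≋ 1L
binom-m-0 m = binom-correct 0 m refl
  (solve 1 (λ x → x := con 1 :* x :* con 1) ≋-refl (m !q)) (monic-positive monic-1)
  where open LaurentSolver

binom-m-m : ∀ m → binom m m ≋ 1L
binom-m-m m = binom-correct m 0 (sym (ℕ.+-identityʳ m))
  (solve 1 (λ x → x := x :* con 1 :* con 1) ≋-refl (m !q)) (monic-positive monic-1)
  where open LaurentSolver

binom-1+a-a : ∀ a → binom (1 ℕ.+ a) a ≋ [ 1 ℕ.+ a ]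
binom-1+a-a a = binom-correct a 1 (ℕ.+-comm 1 a)
  (solve 3 (λ q x y → x :* y := x :* (con 1 :* (con 1 :+ q :* con 0)) :* y) ≋-refl q (a !q) [ suc a ])
  (monic-positive ([]-monic a))
  where open LaurentSolver

[2+a]!≋ : ∀ a → (2 ℕ.+ a) !q ≋ a !q ⊗ 2 !q ⊗ T a
[2+a]!≋ a = begin
  a !q ⊗ [ 1 ℕ.+ a ] ⊗ [ 2 ℕ.+ a ]
    ≈⟨ solve 3 (λ x y z → x :* y :* z := x :* (z :* y)) ≋-refl (a !q) [ 1 ℕ.+ a ] [ 2 ℕ.+ a ] ⟩
  a !q ⊗ ([ 2 ℕ.+ a ] ⊗ [ 1 ℕ.+ a ])
    ≈⟨ R.*-congˡ {a !q} (T-product a) ⟨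
  a !q ⊗ ((1L ⊕ q) ⊗ T a)
    ≈⟨ solve 3 (λ q x t → x :* ((con 1 :+ q) :* t)
         := x :* (con 1 :* (con 1 :+ q :* con 0) :* (con 1 :+ q :* (con 1 :+ q :* con 0))) :* t)
         ≋-refl q (a !q) (T a) ⟩
  a !q ⊗ 2 !q ⊗ T a ∎
  where
  open ≋-Reasoning
  open LaurentSolver

binom-2+a-a : ∀ a → binom (2 ℕ.+ a) a ≋ T a
binom-2+a-a a = binom-correct a 2 (ℕ.+-comm 2 a) ([2+a]!≋ a) (T-positive a)

binom-2+a-2 : ∀ a → binom (2 ℕ.+ a) 2 ≋ T a
binom-2+a-2 a =
  binom-correct 2 a refl (≋-trans ([2+a]!≋ a) (R.*-congʳ {T a} (⊗-comm (a !q) (2 !q)))) (T-positive a)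

-- The coefficients of the continued fraction in terms of `T`

⌈m*2/2⌉ : ∀ m → ⌈ m ℕ.* 2 /2⌉ ≡ m
⌈m*2/2⌉ zero    = refl
⌈m*2/2⌉ (suc m) = cong suc (⌈m*2/2⌉ m)

⌈1+m*2/2⌉ : ∀ m → ⌈ suc (m ℕ.* 2) /2⌉ ≡ suc m
⌈1+m*2/2⌉ zero    = refl
⌈1+m*2/2⌉ (suc m) = cong suc (⌈1+m*2/2⌉ m)

-- The body of `c` with the parity and the upper index abstracted, so that both can be rewritten at
-- once.
cᵣ : ℕ → ℕ → Laurent
cᵣ r m = if r ℕ.≡ᵇ 1 then binom m 2 else q ⊗ binom m 2

c-odd : ∀ a → c (suc (a ℕ.* 2)) ≋ T a
c-odd a = begin
  c (suc (a ℕ.* 2))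
    ≡⟨ cong₂ cᵣ ([m+kn]%n≡m%n 1 a 2) (trans (cong (ℕ._+ 1) (⌈1+m*2/2⌉ a)) (ℕ.+-comm (suc a) 1)) ⟩
  binom (2 ℕ.+ a) 2
    ≈⟨ binom-2+a-2 a ⟩
  T a ∎
  where open ≋-Reasoning

c-even : ∀ a → c (suc a ℕ.* 2) ≋ q ⊗ T a
c-even a = begin
  c (suc a ℕ.* 2)
    ≡⟨ cong₂ cᵣ (m*n%n≡0 (suc a) 2) (trans (cong (ℕ._+ 1) (⌈m*2/2⌉ (suc a))) (ℕ.+-comm (suc a) 1)) ⟩
  q ⊗ binom (2 ℕ.+ a) 2
    ≈⟨ R.*-congˡ {q} (binom-2+a-2 a) ⟩
  q ⊗ T a ∎
  where open ≋-Reasoning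

-- The continued fraction

∑-applyUpTo : ∀ {A : Set} (t : A → Laurent) (f : ℕ → A) n → ∑ (applyUpTo f n) t ≡ ∑< n (t ∘ f)
∑-applyUpTo t f zero    = refl
∑-applyUpTo t f (suc n) = cong (λ s → t (f 0) ⊕ s) (∑-applyUpTo t (f ∘ suc) n)

∑-upTo : ∀ (t : ℕ → Laurent) n → ∑ (upTo n) t ≡ ∑< n t
∑-upTo t = ∑-applyUpTo t id

module Geometric (κ : Laurent) (F : Series) where
  open ≋-Reasoning
  open LaurentSolver

  G : Series
  G = κ ·s· F

  ^S-suc : ∀ k n → (G ^S suc k) (suc n) ≋ κ ⊗ ∑< (suc n) (λ i → F i ⊗ (G ^S k) (n ℕ.∸ i))
  ^S-suc k n = begin
    ∑ (upTo (suc (suc n))) (λ i → G i ⊗ (G ^S k) (suc n ℕ.∸ i))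
      -- The term i = 0 disappears by computation, since `G` has constant term `0L`.
      ≡⟨ ∑-upTo (λ i → G i ⊗ (G ^S k) (suc n ℕ.∸ i)) (suc (suc n)) ⟩
    ∑< (suc n) (λ i → κ ⊗ F i ⊗ (G ^S k) (n ℕ.∸ i))
      ≈⟨ ∑<-cong (suc n) (λ {i} _ → R.*-assoc κ (F i) ((G ^S k) (n ℕ.∸ i))) ⟩
    ∑< (suc n) (λ i → κ ⊗ (F i ⊗ (G ^S k) (n ℕ.∸ i)))
      ≈⟨ ∑<-*ˡ (suc n) κ (λ i → F i ⊗ (G ^S k) (n ℕ.∸ i)) ⟩
    κ ⊗ ∑< (suc n) (λ i → F i ⊗ (G ^S k) (n ℕ.∸ i)) ∎

  ^S-vanishes : ∀ {k n} → n ℕ.< k → (G ^S k) n ≋ 0L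
  ^S-vanishes {suc k} {zero}  _         = ≋-refl
  ^S-vanishes {suc k} {suc n} (s≤s n<k) = begin
    (G ^S suc k) (suc n)
      ≈⟨ ^S-suc k n ⟩
    κ ⊗ ∑< (suc n) (λ i → F i ⊗ (G ^S k) (n ℕ.∸ i))
      ≈⟨ R.*-congˡ {κ} (∑<-zero (suc n) λ {i} _ → ≋-trans
           (R.*-congˡ {F i} (^S-vanishes (ℕ.≤-<-trans (ℕ.m∸n≤m n i) n<k))) (R.zeroʳ (F i))) ⟩
    κ ⊗ 0L
      ≈⟨ R.zeroʳ κ ⟩
    0L ∎

  -- The equation H = 1 + κ s F H for H = 1/(1 - κ s F), read off at degree n + 1. It turns the
  -- geometric sum into a recursion.
  1/[1-]-suc : ∀ n → 1/[1- G ] (suc n) ≋ κ ⊗ ∑< (suc n) (λ i → F i ⊗ 1/[1- G ] (n ℕ.∸ i))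
  1/[1-]-suc n = begin
    ∑ (upTo (suc (suc n))) (λ k → (G ^S k) (suc n))
      ≡⟨ ∑-upTo (λ k → (G ^S k) (suc n)) (suc (suc n)) ⟩
    ∑< (suc n) (λ k → (G ^S suc k) (suc n))
      ≈⟨ ∑<-cong (suc n) (λ {k} _ → ^S-suc k n) ⟩
    ∑< (suc n) (λ k → κ ⊗ ∑< (suc n) (λ i → F i ⊗ (G ^S k) (n ℕ.∸ i)))
      ≈⟨ ∑<-*ˡ (suc n) κ (λ k → ∑< (suc n) (λ i → F i ⊗ (G ^S k) (n ℕ.∸ i))) ⟩
    κ ⊗ ∑< (suc n) (λ k → ∑< (suc n) (λ i → F i ⊗ (G ^S k) (n ℕ.∸ i)))
      ≈⟨ R.*-congˡ {κ} (∑<-swap (suc n) (suc n) (λ k i → F i ⊗ (G ^S k) (n ℕ.∸ i))) ⟩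
    κ ⊗ ∑< (suc n) (λ i → ∑< (suc n) (λ k → F i ⊗ (G ^S k) (n ℕ.∸ i)))
      ≈⟨ R.*-congˡ {κ} (∑<-cong (suc n) λ {i} _ → inner i) ⟩
    κ ⊗ ∑< (suc n) (λ i → F i ⊗ 1/[1- G ] (n ℕ.∸ i)) ∎
    where
    inner : ∀ i → ∑< (suc n) (λ k → F i ⊗ (G ^S k) (n ℕ.∸ i)) ≋ F i ⊗ 1/[1- G ] (n ℕ.∸ i)
    inner i = begin
      ∑< (suc n) (λ k → F i ⊗ (G ^S k) m)
        ≈⟨ ∑<-*ˡ (suc n) (F i) (λ k → (G ^S k) m) ⟩
      F i ⊗ ∑< (suc n) (λ k → (G ^S k) m)
        ≈⟨ R.*-congˡ {F i} (∑<-truncate (λ k → (G ^S k) m) (s≤s (ℕ.m∸n≤m n i)) ^S-vanishes) ⟩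
      F i ⊗ ∑< (suc m) (λ k → (G ^S k) m)
        ≡⟨ cong (F i ⊗_) (∑-upTo (λ k → (G ^S k) m) (suc m)) ⟨
      F i ⊗ 1/[1- G ] m ∎
      where m = n ℕ.∸ i

module _ (γ : ℕ → Laurent) where
  open Paths laurentSemiring γ using (D; D-convolution)
  open ≋-Reasoning

  -- Replacing a tail by 1 at depth N disturbs only powers of s beyond N, because each level
  -- contributes a factor s.
  fraction≋D : ∀ N i n → n ℕ.≤ N → fraction γ i N n ≋ D i n 1
  fraction≋D zero    i zero z≤n = ≋-refl
  fraction≋D (suc N) i n  n≤1+N = strong n n ℕ.≤-refl n≤1+N
    where
    -- The fraction itself recurs on the right at all lower degrees, hence strong induction on n,
    -- with m as its bound, inside the induction on the depth.
    strong : ∀ m n → n ℕ.≤ m → n ℕ.≤ suc N → fraction γ i (suc N) n ≋ D i n 1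
    strong m       zero    _         _         = ≋-refl
    strong (suc m) (suc n) (s≤s n≤m) (s≤s n≤N) = begin
      fraction γ i (suc N) (suc n)
        ≈⟨ Geometric.1/[1-]-suc (γ (suc i)) (fraction γ (suc i) N) n ⟩
      γ (suc i) ⊗ ∑< (suc n) (λ k → fraction γ (suc i) N k ⊗ fraction γ i (suc N) (n ℕ.∸ k))
        ≈⟨ R.*-congˡ {γ (suc i)} (∑<-cong (suc n) λ {k} k≤n → ⊗-cong
             (fraction≋D N (suc i) k (ℕ.≤-trans (ℕ.≤-pred k≤n) n≤N))
             (strong m (n ℕ.∸ k) (ℕ.≤-trans (ℕ.m∸n≤m n k) n≤m)
               (ℕ.≤-trans (ℕ.m∸n≤m n k) (ℕ.m≤n⇒m≤1+n n≤N)))) ⟩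
      γ (suc i) ⊗ ∑< (suc n) (λ k → D (suc i) k 1 ⊗ D i (n ℕ.∸ k) 1)
        ≈⟨ R.*-congˡ {γ (suc i)} (D-convolution i n 1) ⟨
      γ (suc i) ⊗ D i n 2
        ≡⟨ cong (λ j → γ (suc j) ⊗ D i n 2) (ℕ.+-identityʳ i) ⟨
      D i (suc n) 1 ∎

-- The substitution of q⁻¹ for q

⟪⟫-[q⁻¹] : ∀ p φ → ⟪ p [q⁻¹] ⟫ φ ≡ ⟪ p ⟫ (φ ∘ ℤ.-_)
⟪⟫-[q⁻¹] []            φ = refl
⟪⟫-[q⁻¹] ((a , e) ∷ p) φ = cong (λ s → a ℤ.* φ (ℤ.- e) ℤ.+ s) (⟪⟫-[q⁻¹] p φ)

[q⁻¹]-cong : ∀ {p r} → p ≋ r → p [q⁻¹] ≋ r [q⁻¹]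
[q⁻¹]-cong {p} {r} eq .coeff-≡ z = trans (reflect p) (trans (eq .coeff-≡ (ℤ.- z)) (sym (reflect r)))
  where
  open ≡-Reasoning
  reflect : ∀ p → coeff (p [q⁻¹]) z ≡ coeff p (ℤ.- z)
  reflect p = begin
    coeff (p [q⁻¹]) z        ≡⟨ coeff-⟪⟫ (p [q⁻¹]) z ⟩
    ⟪ p [q⁻¹] ⟫ (δ z)        ≡⟨ ⟪⟫-[q⁻¹] p (δ z) ⟩
    ⟪ p ⟫ (δ z ∘ ℤ.-_)       ≡⟨ ⟪⟫-cong p (λ e → cong (λ b → if b then 1ℤ else 0ℤ)
                                  (does-⇔ (mk⇔
                                    (λ { refl → sym (ℤ.neg-involutive e) })
                                    (λ { refl → ℤ.neg-involutive z }))
                                    (ℤ.- e ℤ.≟ z) (e ℤ.≟ ℤ.- z))) ⟩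
    ⟪ p ⟫ (δ (ℤ.- z))        ≡⟨ coeff-⟪⟫ p (ℤ.- z) ⟨
    coeff p (ℤ.- z)          ∎

[q⁻¹]-⊕ : ∀ p r → (p ⊕ r) [q⁻¹] ≡ p [q⁻¹] ⊕ r [q⁻¹]
[q⁻¹]-⊕ p r = List.map-++ _ p r

[q⁻¹]-⊗ : ∀ p r → (p ⊗ r) [q⁻¹] ≋ p [q⁻¹] ⊗ r [q⁻¹]
[q⁻¹]-⊗ p r = ∼⇒≋ λ φ → begin
  ⟪ (p ⊗ r) [q⁻¹] ⟫ φ                                    ≡⟨ ⟪⟫-[q⁻¹] (p ⊗ r) φ ⟩
  ⟪ p ⊗ r ⟫ (φ ∘ ℤ.-_)                                   ≡⟨ ⟪⟫-⊗ p r _ ⟩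
  ⟪ p ⟫ (λ i → ⟪ r ⟫ (λ j → φ (ℤ.- (i ℤ.+ j))))
    ≡⟨ ⟪⟫-cong p (λ i → ⟪⟫-cong r λ j → cong φ (ℤ.neg-distrib-+ i j)) ⟩
  ⟪ p ⟫ (λ i → ⟪ r ⟫ (λ j → φ (ℤ.- i ℤ.+ ℤ.- j)))        ≡⟨ ⟪⟫-cong p (λ i → ⟪⟫-[q⁻¹] r (λ j → φ (ℤ.- i ℤ.+ j))) ⟨
  ⟪ p ⟫ (λ i → ⟪ r [q⁻¹] ⟫ (λ j → φ (ℤ.- i ℤ.+ j)))      ≡⟨ ⟪⟫-[q⁻¹] p _ ⟨
  ⟪ p [q⁻¹] ⟫ (λ i → ⟪ r [q⁻¹] ⟫ (λ j → φ (i ℤ.+ j)))    ≡⟨ ⟪⟫-⊗ (p [q⁻¹]) (r [q⁻¹]) φ ⟨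
  ⟪ p [q⁻¹] ⊗ r [q⁻¹] ⟫ φ                                ∎
  where open ≡-Reasoning

q^-+ : ∀ i j {k} → i ℤ.+ j ≡ k → q^ i ⊗ q^ j ≋ q^ k
q^-+ i j refl = ≋-refl

-- Inversion turns the recursion that adds the top term into the defining one, which adds the
-- constant term.
[]-palindromic : ∀ n → [ suc n ] [q⁻¹] ≋ q^ (ℤ.- + n) ⊗ [ suc n ]
[]-palindromic zero    = ≋-refl
[]-palindromic (suc n) = begin
  [ suc (suc n) ] [q⁻¹]
    ≈⟨ [q⁻¹]-cong ([1+n] (suc n)) ⟩
  ([ suc n ] ⊕ q^ (+ suc n)) [q⁻¹]
    ≡⟨ [q⁻¹]-⊕ [ suc n ] (q^ (+ suc n)) ⟩
  [ suc n ] [q⁻¹] ⊕ u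
    ≈⟨ R.+-congʳ {u} (≋-trans ([]-palindromic n) (R.*-congʳ {[ suc n ]}
         (≋-sym (q^-+ (ℤ.- + suc n) 1ℤ exps)))) ⟩
  u ⊗ q ⊗ [ suc n ] ⊕ u
    ≈⟨ solve 3 (λ u q x → u :* q :* x :+ u := u :* (con 1 :+ q :* x)) ≋-refl u q [ suc n ] ⟩
  u ⊗ [ suc (suc n) ] ∎
  where
  open ≋-Reasoning
  open LaurentSolver
  u = q^ (ℤ.- + suc n)
  exps : ℤ.- + suc n ℤ.+ 1ℤ ≡ ℤ.- + n
  exps = S.solve 1 (λ n → S.:- (S.con 1ℤ S.:+ n) S.:+ S.con 1ℤ S.:= S.:- n) refl (+ n)
    where module S = +-*-Solver

-- Inverting `T-Pascal` yields the defining recursion of `T`, up to a power of `q`; 2a is the degree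
-- of `T a`. The exponent is kept as a sum because it then agrees definitionally with that of a
-- product of two monomials.
T-palindromic : ∀ a → T a [q⁻¹] ≋ q^ (ℤ.- + a ℤ.+ ℤ.- + a) ⊗ T a
T-palindromic zero    = ≋-refl
T-palindromic (suc a) = begin
  T (suc a) [q⁻¹]
    ≈⟨ [q⁻¹]-cong (T-Pascal a) ⟩
  (T a ⊕ q^ (+ suc a) ⊗ [ 2 ℕ.+ a ]) [q⁻¹]
    ≡⟨ [q⁻¹]-⊕ (T a) (q^ (+ suc a) ⊗ [ 2 ℕ.+ a ]) ⟩
  T a [q⁻¹] ⊕ (q^ (+ suc a) ⊗ [ 2 ℕ.+ a ]) [q⁻¹]
    ≈⟨ ⊕-cong (T-palindromic a)
         (≋-trans ([q⁻¹]-⊗ (q^ (+ suc a)) [ 2 ℕ.+ a ]) (R.*-congˡ {u} ([]-palindromic (suc a)))) ⟩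
  q^ (ℤ.- + a ℤ.+ ℤ.- + a) ⊗ T a ⊕ u ⊗ (u ⊗ [ 2 ℕ.+ a ])
    ≈⟨ R.+-congʳ {u ⊗ (u ⊗ [ 2 ℕ.+ a ])} (R.*-congʳ {T a}
         (q^-+ (ℤ.- + suc a ℤ.+ ℤ.- + suc a) (1ℤ ℤ.+ 1ℤ) exps)) ⟨
  u ⊗ u ⊗ (q ⊗ q) ⊗ T a ⊕ u ⊗ (u ⊗ [ 2 ℕ.+ a ])
    ≈⟨ solve 4 (λ u q t x → u :* u :* (q :* q) :* t :+ u :* (u :* x) := u :* u :* (q :* q :* t :+ x)) ≋-refl
         u q (T a) [ 2 ℕ.+ a ] ⟩
  u ⊗ u ⊗ T (suc a) ∎
  where
  open ≋-Reasoning
  open LaurentSolver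
  u = q^ (ℤ.- + suc a)
  exps : ℤ.- + suc a ℤ.+ ℤ.- + suc a ℤ.+ (1ℤ ℤ.+ 1ℤ) ≡ ℤ.- + a ℤ.+ ℤ.- + a
  exps = S.solve 1 (λ a →
    S.:- (S.con 1ℤ S.:+ a) S.:+ S.:- (S.con 1ℤ S.:+ a) S.:+ S.con (1ℤ ℤ.+ 1ℤ) S.:= S.:- a S.:+ S.:- a) refl (+ a)
    where module S = +-*-Solver

-- Step weights

-- The solution of the identity stated at `telescope`: adding (k + 1)x - k a is what makes k drop
-- out.
stepExponent : ℕ → ℕ → ℤ
stepExponent a x = + a ℤ.+ + x ℤ.+ + a ℤ.* + x ℤ.- + a ℤ.* + a

-- A step takes the factor of the first product of a summand indexed by its end and the factor of
-- the second indexed by its start.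
w : ℕ → ℕ → Laurent
w a x = q^ stepExponent a x ⊗ binom (1 ℕ.+ a) x [q⁻¹] ⊗ binom (1 ℕ.+ x) a [q⁻¹]

w-fall : ∀ {a x} → suc x ℕ.< a → w a x ≋ 0L
w-fall {a} {x} x+1<a = ≋-trans (R.*-congˡ {q^ stepExponent a x ⊗ binom (1 ℕ.+ a) x [q⁻¹]}
  ([q⁻¹]-cong (binom-zero x+1<a))) (R.zeroʳ (q^ stepExponent a x ⊗ binom (1 ℕ.+ a) x [q⁻¹]))

w-rise : ∀ {a x} → suc a ℕ.< x → w a x ≋ 0L
w-rise {a} {x} a+1<x = R.*-congʳ {binom (1 ℕ.+ x) a [q⁻¹]} (≋-trans
  (R.*-congˡ {q^ stepExponent a x} ([q⁻¹]-cong (binom-zero a+1<x))) (R.zeroʳ (q^ stepExponent a x)))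

w-level : ∀ a → w a a ≋ [ 1 ℕ.+ a ] ⊗ [ 1 ℕ.+ a ]
w-level a = begin
  q^ stepExponent a a ⊗ binom (1 ℕ.+ a) a [q⁻¹] ⊗ binom (1 ℕ.+ a) a [q⁻¹]
    ≈⟨ ⊗-cong (R.*-congˡ {q^ stepExponent a a} binom⁻¹) binom⁻¹ ⟩
  q^ stepExponent a a ⊗ (u ⊗ x) ⊗ (u ⊗ x)
    ≈⟨ solve 3 (λ e u x → e :* (u :* x) :* (u :* x) := e :* (u :* u) :* (x :* x)) ≋-refl (q^ stepExponent a a) u x ⟩
  q^ stepExponent a a ⊗ (u ⊗ u) ⊗ (x ⊗ x)
    ≈⟨ R.*-congʳ {x ⊗ x} (q^-+ (stepExponent a a) (ℤ.- + a ℤ.+ ℤ.- + a) exps) ⟩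
  1L ⊗ (x ⊗ x)
    ≈⟨ R.*-identityˡ (x ⊗ x) ⟩
  x ⊗ x ∎
  where
  open ≋-Reasoning
  open LaurentSolver
  u = q^ (ℤ.- + a)
  x = [ 1 ℕ.+ a ]
  binom⁻¹ : binom (1 ℕ.+ a) a [q⁻¹] ≋ u ⊗ x
  binom⁻¹ = ≋-trans ([q⁻¹]-cong (binom-1+a-a a)) ([]-palindromic a)
  exps : stepExponent a a ℤ.+ (ℤ.- + a ℤ.+ ℤ.- + a) ≡ 0ℤ
  exps = S.solve 1 (λ a → a S.:+ a S.:+ a S.:* a S.:- a S.:* a S.:+ (S.:- a S.:+ S.:- a) S.:= S.con 0ℤ) refl (+ a)
    where module S = +-*-Solver

w-up : ∀ a → w a (suc a) ≋ q^ (1ℤ ℤ.+ + a) ⊗ T a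
w-up a = begin
  q^ e ⊗ binom (1 ℕ.+ a) (1 ℕ.+ a) [q⁻¹] ⊗ binom (2 ℕ.+ a) a [q⁻¹]
    ≈⟨ ⊗-cong (R.*-congˡ {q^ e} ([q⁻¹]-cong (binom-m-m (1 ℕ.+ a))))
              (≋-trans ([q⁻¹]-cong (binom-2+a-a a)) (T-palindromic a)) ⟩
  q^ e ⊗ 1L ⊗ (u ⊗ T a)
    ≈⟨ solve 3 (λ e u t → e :* con 1 :* (u :* t) := e :* u :* t) ≋-refl (q^ e) u (T a) ⟩
  q^ e ⊗ u ⊗ T a
    ≈⟨ R.*-congʳ {T a} (q^-+ e (ℤ.- + a ℤ.+ ℤ.- + a) exps) ⟩
  q^ (1ℤ ℤ.+ + a) ⊗ T a ∎
  where
  open ≋-Reasoning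
  open LaurentSolver
  e = stepExponent a (suc a)
  u = q^ (ℤ.- + a ℤ.+ ℤ.- + a)
  exps : e ℤ.+ (ℤ.- + a ℤ.+ ℤ.- + a) ≡ 1ℤ ℤ.+ + a
  exps = S.solve 1 (λ a → let x = S.con 1ℤ S.:+ a in
    a S.:+ x S.:+ a S.:* x S.:- a S.:* a S.:+ (S.:- a S.:+ S.:- a) S.:= x) refl (+ a)
    where module S = +-*-Solver

-- The power of `q` is negative for a > 0; multiplied by the q^(1 + a) of the matching rise it
-- leaves the single `q` of `w-peak`.
w-down : ∀ a → w (suc a) a ≋ q^ (ℤ.- + a) ⊗ T a
w-down a = begin
  q^ e ⊗ binom (2 ℕ.+ a) a [q⁻¹] ⊗ binom (1 ℕ.+ a) (1 ℕ.+ a) [q⁻¹]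
    ≈⟨ ⊗-cong (R.*-congˡ {q^ e} (≋-trans ([q⁻¹]-cong (binom-2+a-a a)) (T-palindromic a)))
              ([q⁻¹]-cong (binom-m-m (1 ℕ.+ a))) ⟩
  q^ e ⊗ (u ⊗ T a) ⊗ 1L
    ≈⟨ solve 3 (λ e u t → e :* (u :* t) :* con 1 := e :* u :* t) ≋-refl (q^ e) u (T a) ⟩
  q^ e ⊗ u ⊗ T a
    ≈⟨ R.*-congʳ {T a} (q^-+ e (ℤ.- + a ℤ.+ ℤ.- + a) exps) ⟩
  q^ (ℤ.- + a) ⊗ T a ∎
  where
  open ≋-Reasoning
  open LaurentSolver
  e = stepExponent (suc a) a
  u = q^ (ℤ.- + a ℤ.+ ℤ.- + a)
  exps : e ℤ.+ (ℤ.- + a ℤ.+ ℤ.- + a) ≡ ℤ.- + a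
  exps = S.solve 1 (λ a → let x = S.con 1ℤ S.:+ a in
    x S.:+ a S.:+ x S.:* a S.:- x S.:* x S.:+ (S.:- a S.:+ S.:- a) S.:= S.:- a) refl (+ a)
    where module S = +-*-Solver

w-flat₀ : w 0 0 ≋ c 1
w-flat₀ = ≋-trans (w-level 0) (≋-sym (c-odd 0))

w-flat : ∀ a → w (suc a) (suc a) ≋ c (suc a ℕ.* 2) ⊕ c (suc (suc a ℕ.* 2))
w-flat a = begin
  w (suc a) (suc a)                              ≈⟨ w-level (suc a) ⟩
  [ 2 ℕ.+ a ] ⊗ [ 2 ℕ.+ a ]                      ≈⟨ T-square a ⟨
  T (suc a) ⊕ q ⊗ T a                            ≈⟨ ⊕-comm (T (suc a)) (q ⊗ T a) ⟩
  q ⊗ T a ⊕ T (suc a)                            ≈⟨ ⊕-cong (c-even a) (c-odd (suc a)) ⟨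
  c (suc a ℕ.* 2) ⊕ c (suc (suc a ℕ.* 2))        ∎
  where open ≋-Reasoning

w-peak : ∀ a → w a (suc a) ⊗ w (suc a) a ≋ c (suc (a ℕ.* 2)) ⊗ c (suc a ℕ.* 2)
w-peak a = begin
  w a (suc a) ⊗ w (suc a) a
    ≈⟨ ⊗-cong (w-up a) (w-down a) ⟩
  (u ⊗ T a) ⊗ (v ⊗ T a)
    ≈⟨ solve 3 (λ u v t → (u :* t) :* (v :* t) := (u :* v) :* (t :* t)) ≋-refl u v (T a) ⟩
  (u ⊗ v) ⊗ (T a ⊗ T a)
    ≈⟨ R.*-congʳ {T a ⊗ T a} (q^-+ (1ℤ ℤ.+ + a) (ℤ.- + a) exps) ⟩
  q ⊗ (T a ⊗ T a)
    ≈⟨ solve 2 (λ q t → q :* (t :* t) := t :* (q :* t)) ≋-refl q (T a) ⟩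
  T a ⊗ (q ⊗ T a)
    ≈⟨ ⊗-cong (c-odd a) (c-even a) ⟨
  c (suc (a ℕ.* 2)) ⊗ c (suc a ℕ.* 2) ∎
  where
  open ≋-Reasoning
  open LaurentSolver
  u = q^ (1ℤ ℤ.+ + a)
  v = q^ (ℤ.- + a)
  exps : 1ℤ ℤ.+ + a ℤ.+ ℤ.- + a ≡ 1ℤ
  exps = S.solve 1 (λ a → S.con 1ℤ S.:+ a S.:+ S.:- a S.:= S.con 1ℤ) refl (+ a)
    where module S = +-*-Solver

open Paths laurentSemiring c using (D; module Motzkin)
open Motzkin w w-fall w-flat₀ w-flat w-peak using (M; M≈D)

-- Summands of h as weights of paths

-- One indexed fold for both `∏` and `∑ℤ`. Counting from 0 lets the index run in step with the
-- recursion on vectors.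
fold< : {A : Set} → (A → A → A) → A → ℕ → (ℕ → A) → A
fold< _∙_ ε zero    t = ε
fold< _∙_ ε (suc n) t = t 0 ∙ fold< _∙_ ε n (t ∘ suc)

module _ {A : Set} (_∙_ : A → A → A) (ε : A) where

  fold<-cong : ∀ n {s t} → s ≗ t → fold< _∙_ ε n s ≡ fold< _∙_ ε n t
  fold<-cong zero    eq = refl
  fold<-cong (suc n) eq = cong₂ _∙_ (eq 0) (fold<-cong n (eq ∘ suc))

  foldr-[1⋯] : ∀ n t → foldr (λ x s → t x ∙ s) ε [1⋯ n ] ≡ fold< _∙_ ε n (t ∘ suc)
  foldr-[1⋯] n t = go n id
    where
    go : ∀ n (f : ℕ → ℕ) →
         foldr (λ x s → t x ∙ s) ε (map suc (applyUpTo f n)) ≡ fold< _∙_ ε n (t ∘ suc ∘ f)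
    go zero    f = refl
    go (suc n) f = cong (t (suc (f 0)) ∙_) (go n (f ∘ suc))

-- The two products and the exponent of a summand, for (f₁ , … , f_m) preceded by f₀ = a at position k.
rises falls : ∀ {m} → ℕ → Vec ℕ m → Laurent
rises a []      = 1L
rises a (x ∷ f) = binom (1 ℕ.+ a) x ⊗ rises x f
falls a []      = binom 1 a ⊗ 1L
falls a (x ∷ f) = binom (1 ℕ.+ x) a ⊗ falls x f

cost : ∀ {m} → ℕ → ℕ → Vec ℕ m → ℤ
cost k a []      = (+ k ℤ.- + a) ℤ.* (1ℤ ℤ.- + a ℤ.+ 0ℤ) ℤ.+ 0ℤ
cost k a (x ∷ f) = (+ k ℤ.- + a) ℤ.* (1ℤ ℤ.- + a ℤ.+ + x) ℤ.+ cost (suc k) x f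

∏-rises : ∀ {m} (f : Vec ℕ m) → ∏ [1⋯ m ] (λ k → binom (1 ℕ.+ f at (k ℕ.∸ 1)) (f at k)) ≡ rises 0 f
∏-rises {m} f = trans (foldr-[1⋯] _⊗_ 1L m (λ k → binom (1 ℕ.+ f at (k ℕ.∸ 1)) (f at k))) (start f)
  where
  go : ∀ {m} x (f : Vec ℕ m) →
       fold< _⊗_ 1L m (λ j → binom (1 ℕ.+ (x ∷ f) at suc j) (f at suc j)) ≡ rises x f
  go x []      = refl
  go x (y ∷ f) = cong (binom (1 ℕ.+ x) y ⊗_) (go y f)
  start : ∀ {m} (f : Vec ℕ m) → fold< _⊗_ 1L m (λ j → binom (1 ℕ.+ f at j) (f at suc j)) ≡ rises 0 f
  start []      = refl
  start (x ∷ f) = cong (binom 1 x ⊗_) (go x f)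

-- `falls 0 f` has one factor more than the product, that of k = 0. As f₀ = 0, this is a binomial
-- over 0, which equals 1.
∏-falls : ∀ {m} (f : Vec ℕ m) → ∏ [1⋯ m ] (λ k → binom (1 ℕ.+ f at suc k) (f at k)) ≋ falls 0 f
∏-falls {m} f = ≋-trans
  (R.reflexive (foldr-[1⋯] _⊗_ 1L m (λ k → binom (1 ℕ.+ f at suc k) (f at k)))) (start f)
  where
  go : ∀ {m} x (f : Vec ℕ m) →
       fold< _⊗_ 1L (suc m) (λ j → binom (1 ℕ.+ (x ∷ f) at suc (suc j)) ((x ∷ f) at suc j)) ≡ falls x f
  go x []      = refl
  go x (y ∷ f) = cong (binom (1 ℕ.+ y) x ⊗_) (go y f)
  start : ∀ {m} (f : Vec ℕ m) →
          fold< _⊗_ 1L m (λ j → binom (1 ℕ.+ f at suc (suc j)) (f at suc j)) ≋ falls 0 f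
  start []      = ≋-sym (≋-trans (R.*-identityʳ (binom 1 0)) (binom-m-0 1))
  start (x ∷ f) = ≋-trans (R.reflexive (go x f))
    (≋-sym (≋-trans (R.*-congʳ {falls x f} (binom-m-0 (suc x))) (R.*-identityˡ (falls x f))))

exponent-cost : ∀ {m} (f : Vec ℕ m) → exponent (suc m) f ≡ cost 0 0 f
exponent-cost {m} f = trans (foldr-[1⋯] ℤ._+_ 0ℤ m (λ k → term k (f at k) (f at suc k))) (start f)
  where
  term : ℕ → ℕ → ℕ → ℤ
  term k a x = (+ k ℤ.- + a) ℤ.* (1ℤ ℤ.- + a ℤ.+ + x)
  go : ∀ {m} k x (f : Vec ℕ m) →
       fold< ℤ._+_ 0ℤ (suc m) (λ j → term (j ℕ.+ k) ((x ∷ f) at suc j) ((x ∷ f) at suc (suc j))) ≡ cost k x f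
  go k x []      = refl
  go {suc m} k x (y ∷ f) = cong (λ s → term k x y ℤ.+ s) (trans
    (fold<-cong ℤ._+_ 0ℤ (suc m) λ j →
        cong (λ i → term i ((y ∷ f) at suc j) ((y ∷ f) at suc (suc j))) (sym (ℕ.+-suc j k)))
    (go (suc k) y f))
  start : ∀ {m} (f : Vec ℕ m) →
          fold< ℤ._+_ 0ℤ m (λ j → term (suc j) (f at suc j) (f at suc (suc j))) ≡ cost 0 0 f
  start []      = refl
  -- The extra term of `cost` at k = 0 is zero through its first factor, 0 - 0.
  start {suc m} (x ∷ f) = sym (trans (cong (λ s → s ℤ.+ cost 1 x f) (ℤ.*-zeroˡ (1ℤ ℤ.- 0ℤ ℤ.+ + x)))
    (trans (ℤ.+-identityˡ (cost 1 x f)) (sym (trans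
      (fold<-cong ℤ._+_ 0ℤ (suc m) λ j →
        cong (λ i → term i ((x ∷ f) at suc j) ((x ∷ f) at suc (suc j))) (ℕ.+-comm 1 j))
      (go 1 x f)))))

stepExponents : ∀ {m} → ℕ → Vec ℕ m → ℤ
stepExponents a []      = stepExponent a 0
stepExponents a (x ∷ f) = stepExponent a x ℤ.+ stepExponents x f

-- The sum of the m numbers from k on: the terms that do not telescope. With k = 0 it becomes the
-- exponent in `h̃`.
range-sum : ℕ → ℕ → ℕ
range-sum k zero    = 0
range-sum k (suc m) = k ℕ.+ range-sum (suc k) m

range-sum-double : ∀ k m → range-sum k (suc m) ℕ.* 2 ≡ suc m ℕ.* (k ℕ.+ k ℕ.+ m)
range-sum-double k zero    = solve 1 (λ k → (k :+ con 0) :* con 2 := con 1 :* (k :+ k :+ con 0)) refl k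
  where open Data.Nat.Solver.+-*-Solver
range-sum-double k (suc m) = begin
  (k ℕ.+ s) ℕ.* 2                                ≡⟨ ℕ.*-distribʳ-+ 2 k s ⟩
  k ℕ.* 2 ℕ.+ s ℕ.* 2                            ≡⟨ cong (k ℕ.* 2 ℕ.+_) (range-sum-double (suc k) m) ⟩
  k ℕ.* 2 ℕ.+ suc m ℕ.* (suc k ℕ.+ suc k ℕ.+ m)
    ≡⟨ solve 2 (λ k m → k :* con 2 :+ (con 1 :+ m) :* (con 1 :+ k :+ (con 1 :+ k) :+ m)
         := (con 2 :+ m) :* (k :+ k :+ (con 1 :+ m))) refl k m ⟩
  suc (suc m) ℕ.* (k ℕ.+ k ℕ.+ suc m)            ∎
  where
  open ≡-Reasoning
  open Data.Nat.Solver.+-*-Solver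
  s = range-sum (suc k) (suc m)

triangular : ∀ m → suc m ℕ.* m / 2 ≡ range-sum 0 (suc m)
triangular m = trans (cong (_/ 2) (sym (range-sum-double 0 m))) (m*n/n≡m (range-sum 0 (suc m)) 2)

-- A step from height a at position k to height x at position k + 1 satisfies
-- stepExponent a x + (k - a)(1 - a + x) = k + ((k + 1)x - k a), and the last bracket telescopes.
telescope : ∀ {m} k a (f : Vec ℕ m) →
            stepExponents a f ℤ.+ cost k a f ≡ + range-sum k (suc m) ℤ.- + k ℤ.* + a
telescope k a [] = solve 2 (λ k a →
  (a :+ con 0ℤ :+ a :* con 0ℤ :- a :* a) :+ ((k :- a) :* (con 1ℤ :- a :+ con 0ℤ) :+ con 0ℤ)
  := (k :+ con 0ℤ) :- k :* a) refl (+ k) (+ a)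
  where open +-*-Solver
telescope {suc m} k a (x ∷ f) = begin
  (stepExponent a x ℤ.+ u) ℤ.+ ((+ k ℤ.- + a) ℤ.* (1ℤ ℤ.- + a ℤ.+ + x) ℤ.+ v)
    ≡⟨ solve 4 (λ e u t v → (e :+ u) :+ (t :+ v) := e :+ t :+ (u :+ v)) refl
         (stepExponent a x) u ((+ k ℤ.- + a) ℤ.* (1ℤ ℤ.- + a ℤ.+ + x)) v ⟩
  stepExponent a x ℤ.+ (+ k ℤ.- + a) ℤ.* (1ℤ ℤ.- + a ℤ.+ + x) ℤ.+ (u ℤ.+ v)
    ≡⟨ cong (λ s → stepExponent a x ℤ.+ (+ k ℤ.- + a) ℤ.* (1ℤ ℤ.- + a ℤ.+ + x) ℤ.+ s) (telescope (suc k) x f) ⟩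
  stepExponent a x ℤ.+ (+ k ℤ.- + a) ℤ.* (1ℤ ℤ.- + a ℤ.+ + x) ℤ.+ (+ s ℤ.- + suc k ℤ.* + x)
    ≡⟨ solve 4 (λ k a x s →
         (a :+ x :+ a :* x :- a :* a) :+ (k :- a) :* (con 1ℤ :- a :+ x) :+ (s :- (con 1ℤ :+ k) :* x)
         := (k :+ s) :- k :* a) refl (+ k) (+ a) (+ x) (+ s) ⟩
  + (k ℕ.+ s) ℤ.- + k ℤ.* + a ∎
  where
  open ≡-Reasoning
  open +-*-Solver
  u = stepExponents x f
  v = cost (suc k) x f
  s = range-sum (suc k) (suc m)

weight : ∀ {m} → ℕ → Vec ℕ m → Laurent
weight a []      = w a 0
weight a (x ∷ f) = w a x ⊗ weight x f

weight-factors : ∀ {m} a (f : Vec ℕ m) →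
                 weight a f ≋ q^ stepExponents a f ⊗ rises a f [q⁻¹] ⊗ falls a f [q⁻¹]
-- The final step to height 0 has a factor in `falls` but none in `rises`; the missing binomial over
-- 0 is 1.
weight-factors a [] = ⊗-cong
  (R.*-congˡ {q^ stepExponent a 0} ([q⁻¹]-cong (binom-m-0 (suc a))))
  ([q⁻¹]-cong (≋-sym (R.*-identityʳ (binom 1 a))))
weight-factors a (x ∷ f) = begin
  (q^ e ⊗ b [q⁻¹] ⊗ b′ [q⁻¹]) ⊗ weight x f
    ≈⟨ R.*-congˡ {w a x} (weight-factors x f) ⟩
  (q^ e ⊗ b [q⁻¹] ⊗ b′ [q⁻¹]) ⊗ (q^ e′ ⊗ rises x f [q⁻¹] ⊗ falls x f [q⁻¹])
    ≈⟨ solve 6 (λ x y z x′ y′ z′ → (x :* y :* z) :* (x′ :* y′ :* z′) := (x :* x′) :* (y :* y′) :* (z :* z′)) ≋-refl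
         (q^ e) (b [q⁻¹]) (b′ [q⁻¹]) (q^ e′) (rises x f [q⁻¹]) (falls x f [q⁻¹]) ⟩
  (q^ e ⊗ q^ e′) ⊗ (b [q⁻¹] ⊗ rises x f [q⁻¹]) ⊗ (b′ [q⁻¹] ⊗ falls x f [q⁻¹])
    ≈⟨ ⊗-cong (R.*-congˡ {q^ (e ℤ.+ e′)} ([q⁻¹]-⊗ b (rises x f))) ([q⁻¹]-⊗ b′ (falls x f)) ⟨
  q^ (e ℤ.+ e′) ⊗ (b ⊗ rises x f) [q⁻¹] ⊗ (b′ ⊗ falls x f) [q⁻¹] ∎
  where
  open ≋-Reasoning
  open LaurentSolver
  e = stepExponent a x
  e′ = stepExponents x f
  b = binom (1 ℕ.+ a) x
  b′ = binom (1 ℕ.+ x) a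

summand-weight : ∀ {m} (f : Vec ℕ m) →
                 q^ (+ (suc m ℕ.* m / 2)) ⊗ summand (suc m) f [q⁻¹] ≋ weight 0 f
summand-weight {m} f = begin
  q^ N ⊗ (q^ e ⊗ P ⊗ Q) [q⁻¹]
    ≈⟨ R.*-congˡ {q^ N} (≋-trans ([q⁻¹]-⊗ (q^ e ⊗ P) Q) (R.*-congʳ {Q [q⁻¹]} ([q⁻¹]-⊗ (q^ e) P))) ⟩
  q^ N ⊗ (q^ (ℤ.- e) ⊗ P [q⁻¹] ⊗ Q [q⁻¹])
    ≈⟨ solve 4 (λ n e p q → n :* (e :* p :* q) := n :* e :* p :* q) ≋-refl (q^ N) (q^ (ℤ.- e)) (P [q⁻¹]) (Q [q⁻¹]) ⟩
  q^ N ⊗ q^ (ℤ.- e) ⊗ P [q⁻¹] ⊗ Q [q⁻¹]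
    ≈⟨ ⊗-cong (⊗-cong (q^-+ N (ℤ.- e) exps) (R.reflexive (cong _[q⁻¹] (∏-rises f)))) ([q⁻¹]-cong (∏-falls f)) ⟩
  q^ stepExponents 0 f ⊗ rises 0 f [q⁻¹] ⊗ falls 0 f [q⁻¹]
    ≈⟨ weight-factors 0 f ⟨
  weight 0 f ∎
  where
  open ≋-Reasoning
  open LaurentSolver
  N = + (suc m ℕ.* m / 2)
  e = exponent (suc m) f
  P = ∏ [1⋯ m ] λ k → binom (1 ℕ.+ f at (k ℕ.∸ 1)) (f at k)
  Q = ∏ [1⋯ m ] λ k → binom (1 ℕ.+ f at suc k) (f at k)
  exps : N ℤ.- e ≡ stepExponents 0 f
  exps = S.begin
    N ℤ.- e
      S.≡⟨ cong₂ ℤ._-_ (trans (cong +_ (triangular m)) (sym (trans (telescope 0 0 f) (ℤ.+-identityʳ _))))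
           (exponent-cost f) ⟩
    stepExponents 0 f ℤ.+ cost 0 0 f ℤ.- cost 0 0 f
      S.≡⟨ Z.solve 2 (λ u v → u Z.:+ v Z.:- v Z.:= u) refl (stepExponents 0 f) (cost 0 0 f) ⟩
    stepExponents 0 f S.∎
    where
    module S = ≡-Reasoning
    module Z = +-*-Solver

-- Summation over all tuples

∑-++ : {A : Set} (xs ys : List A) (t : A → Laurent) → ∑ (xs ++ ys) t ≋ ∑ xs t ⊕ ∑ ys t
∑-++ []       ys t = ≋-refl
∑-++ (x ∷ xs) ys t = ≋-trans (R.+-congˡ {t x} (∑-++ xs ys t)) (≋-sym (R.+-assoc (t x) (∑ xs t) (∑ ys t)))

∑-cong : {A : Set} (xs : List A) {s t : A → Laurent} → (∀ x → s x ≋ t x) → ∑ xs s ≋ ∑ xs t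
∑-cong []       eq = ≋-refl
∑-cong (x ∷ xs) eq = ⊕-cong (eq x) (∑-cong xs eq)

∑-*ˡ : {A : Set} (xs : List A) (p : Laurent) (t : A → Laurent) → ∑ xs (λ x → p ⊗ t x) ≋ p ⊗ ∑ xs t
∑-*ˡ []       p t = ≋-sym (R.zeroʳ p)
∑-*ˡ (x ∷ xs) p t = ≋-trans (R.+-congˡ {p ⊗ t x} (∑-*ˡ xs p t)) (≋-sym (R.distribˡ p (t x) (∑ xs t)))

∑-[q⁻¹] : {A : Set} (xs : List A) (t : A → Laurent) → (∑ xs t) [q⁻¹] ≡ ∑ xs (λ x → t x [q⁻¹])
∑-[q⁻¹] []       t = refl
∑-[q⁻¹] (x ∷ xs) t = trans ([q⁻¹]-⊕ (t x) (∑ xs t)) (cong (t x [q⁻¹] ⊕_) (∑-[q⁻¹] xs t))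

∑-map : {A B : Set} (g : A → B) (xs : List A) (t : B → Laurent) → ∑ (map g xs) t ≡ ∑ xs (t ∘ g)
∑-map g []       t = refl
∑-map g (x ∷ xs) t = cong (t (g x) ⊕_) (∑-map g xs t)

∑-cartesianProductWith : {A B C : Set} (g : A → B → C) (xs : List A) (ys : List B) (t : C → Laurent) →
                         ∑ (cartesianProductWith g xs ys) t ≋ ∑ xs (λ x → ∑ ys (λ y → t (g x y)))
∑-cartesianProductWith g []       ys t = ≋-refl
∑-cartesianProductWith g (x ∷ xs) ys t = ≋-trans (∑-++ (map (g x) ys) (cartesianProductWith g xs ys) t)
  (⊕-cong (R.reflexive (∑-map (g x) ys t)) (∑-cartesianProductWith g xs ys t))

-- The bound b is no restriction, since a path rises by at most 1 in each step.
∑-tuples≋M : ∀ {b} m a → a ℕ.+ m ℕ.≤ b → ∑ (tuples b m) (weight a) ≋ M (suc m) a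
-- The last step must reach height 0, so of the sum defining `M 1 a` only x = 0 survives.
∑-tuples≋M zero a _ = ⊕-cong (≋-sym (R.*-identityʳ (w a 0)))
  (≋-sym (∑<-zero (suc a) λ {x} _ → R.zeroʳ (w a (suc x))))
∑-tuples≋M {b} (suc m) a a+1+m≤b = begin
  ∑ (tuples b (suc m)) (weight a)
    ≈⟨ ∑-cartesianProductWith _∷_ (upTo (suc b)) (tuples b m) (weight a) ⟩
  ∑ (upTo (suc b)) (λ x → ∑ (tuples b m) (λ f → w a x ⊗ weight x f))
    ≈⟨ ∑-cong (upTo (suc b)) (λ x → ∑-*ˡ (tuples b m) (w a x) (weight x)) ⟩
  ∑ (upTo (suc b)) (λ x → w a x ⊗ ∑ (tuples b m) (weight x))
    ≡⟨ ∑-upTo (λ x → w a x ⊗ ∑ (tuples b m) (weight x)) (suc b) ⟩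
  ∑< (suc b) (λ x → w a x ⊗ ∑ (tuples b m) (weight x))
    ≈⟨ ∑<-truncate (λ x → w a x ⊗ ∑ (tuples b m) (weight x)) (s≤s (ℕ.≤-trans (ℕ.m≤m+n (suc a) m) 1+a+m≤b))
         (λ {x} a+1<x → R.*-congʳ {∑ (tuples b m) (weight x)} (w-rise a+1<x)) ⟩
  ∑< (suc (suc a)) (λ x → w a x ⊗ ∑ (tuples b m) (weight x))
    ≈⟨ ∑<-cong (suc (suc a)) (λ {x} x<a+2 → R.*-congˡ {w a x} (∑-tuples≋M m x
         (ℕ.≤-trans (ℕ.+-monoˡ-≤ m (ℕ.≤-pred x<a+2)) 1+a+m≤b))) ⟩
  M (suc (suc m)) a ∎
  where
  open ≋-Reasoning
  1+a+m≤b : suc a ℕ.+ m ℕ.≤ b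
  1+a+m≤b = subst (ℕ._≤ b) (ℕ.+-suc a m) a+1+m≤b

h̃≋M : ∀ n → h̃ n ≋ M n 0
h̃≋M zero    = ≋-refl
h̃≋M (suc m) = begin
  qᴺ ⊗ (∑ (tuples m m) (summand (suc m))) [q⁻¹]
    ≡⟨ cong (qᴺ ⊗_) (∑-[q⁻¹] (tuples m m) (summand (suc m))) ⟩
  qᴺ ⊗ ∑ (tuples m m) (λ f → summand (suc m) f [q⁻¹])
    ≈⟨ ∑-*ˡ (tuples m m) qᴺ (λ f → summand (suc m) f [q⁻¹]) ⟨
  ∑ (tuples m m) (λ f → qᴺ ⊗ summand (suc m) f [q⁻¹])
    ≈⟨ ∑-cong (tuples m m) summand-weight ⟩
  ∑ (tuples m m) (weight 0)
    ≈⟨ ∑-tuples≋M m 0 ℕ.≤-refl ⟩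
  M (suc m) 0 ∎
  where
  open ≋-Reasoning
  qᴺ = q^ (+ (suc m ℕ.* m / 2))

mainTheorem3 : (convergent c ⟶ h̃) × (c 1 ≈ 1L) × (c 2 ≈ q)
-- The coefficient of sⁿ is final from the n-th convergent on.
mainTheorem3 = (λ n → n , λ N n≤N → coeff-≡ (begin
    convergent c N n   ≈⟨ fraction≋D c N 0 n n≤N ⟩
    D 0 n 1            ≈⟨ M≈D n ⟨
    M n 0              ≈⟨ h̃≋M n ⟨
    h̃ n                ∎))
  , coeff-≡ (c-odd 0)
  , coeff-≡ (≋-trans (c-even 0) (R.*-identityʳ q))
  where open ≋-Reasoning
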